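{- Let $n=n_1n_2$ be a square-free odd integer which is divisible by neither $7$ nor $13$, where $n_1=\prod_{i=1}^r p_i$ and $n_2=\prod_{j=1}^s q_j$ with primes $p_i\equiv 1 \pmod 3$ and $q_j\equiv 2\pmod 3$. Let $T_n=\{a^3 \bmod n : a\in\mathbb{Z}_n^*\}$. Then (i) $D_{T_n}(\mathbb{Z}_n)=2\Omega(n_1)+\Omega(n_2)+1$, and (ii) $\mathsf{E}_{T_n}(\mathbb{Z}_n)=n+2\Omega(n_1)+\Omega(n_2)$.
   Context: $\mathbb{Z}_n=\mathbb{Z}/n\mathbb{Z}$ and $\mathbb{Z}_n^*$ is its group of units. $\Omega(m)$ denotes the number of prime factors of $m$ counted with multiplicity. A sequence over $\mathbb{Z}_n$ is a finite unordered list (multiset) $x_1\cdot x_2\cdots x_k$ of elements of $\mathbb{Z}_n$; a subsequence is a sub-multiset. For a nonempty set of weights $A\subseteq \mathbb{Z}_n$ (residues viewed as integers in $[1,n-1]$), a sequence $x_1\cdots x_k$ is an $A$-weighted zero-sum sequence if there exist $a_1,\dots,a_k\in A$ with $\sum_{i=1}^k a_ix_i=0$ in $\mathbb{Z}_n$. $D_A(\mathbb{Z}_n)$ is the least positive integer $\ell$ such that every sequence over $\mathbb{Z}_n$ of length $\ell$ has a non-empty $A$-weighted zero-sum subsequence. $\mathsf{E}_A(\mathbb{Z}_n)$ is the least positive integer $\ell$ such that every sequence over $\mathbb{Z}_n$ of length $\ell$ has an $A$-weighted zero-sum subsequence of length $n$. -}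

module Defs where

open import Data.Nat using (ℕ; zero; suc; _+_; _*_; _^_; _≤_)
open import Data.Nat.Divisibility using (_∣_)
open import Data.Nat.Coprimality using (Coprime)
open import Data.Fin using (Fin; toℕ)
open import Data.List using (List; []; _∷_; length)
open import Data.List.Relation.Binary.Sublist.Propositional using (_⊆_)
open import Data.Product using (Σ; ∃; _×_; _,_)
open import Relation.Binary.PropositionalEquality using (_≡_)

IsUnit : (n : ℕ) → Fin n → Set
IsUnit n a = Coprime (toℕ a) n

-- T_n = { a^3 mod n : a ∈ Z_n^* } as a predicate on Z_n:
-- w ∈ T_n iff w ≡ a^3 (mod n) for some unit a (w is already reduced, being in Fin n).
CubeUnit : (n : ℕ) → Fin n → Set
CubeUnit n w = Σ (Fin n) λ a → IsUnit n a × ∃ λ k → toℕ a ^ 3 ≡ toℕ w + k * n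

data WSum (n : ℕ) (A : Fin n → Set) : List (Fin n) → ℕ → Set where
  []  : WSum n A [] 0
  _∷_ : ∀ {a x xs s} → A a → WSum n A xs s → WSum n A (x ∷ xs) (toℕ a * toℕ x + s)

WZeroSum : (n : ℕ) → (Fin n → Set) → List (Fin n) → Set
WZeroSum n A xs = ∃ λ s → WSum n A xs s × n ∣ s

-- Every sequence of length ℓ has a nonempty A-weighted zero-sum subsequence.
-- (Sequences are lists; sub-multisets correspond to sublists.)
DProp : (n : ℕ) → (Fin n → Set) → ℕ → Set
DProp n A ℓ = (xs : List (Fin n)) → length xs ≡ ℓ →
  ∃ λ ys → ys ⊆ xs × 1 ≤ length ys × WZeroSum n A ys

EProp : (n : ℕ) → (Fin n → Set) → ℕ → Set
EProp n A ℓ = (xs : List (Fin n)) → length xs ≡ ℓ →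
  ∃ λ ys → ys ⊆ xs × length ys ≡ n × WZeroSum n A ys

IsLeastPos : (ℕ → Set) → ℕ → Set
IsLeastPos P ℓ = 1 ≤ ℓ × P ℓ × (∀ m → 1 ≤ m → P m → ℓ ≤ m)

DavenportW : (n : ℕ) → (Fin n → Set) → ℕ → Set
DavenportW n A ℓ = IsLeastPos (DProp n A) ℓ

EGZW : (n : ℕ) → (Fin n → Set) → ℕ → Set
EGZW n A ℓ = IsLeastPos (EProp n A) ℓ

{-# OPTIONS --safe #-}
-- Let p ≡ 1 (mod 3) be a prime, p = 3k + 1, and let t i j l count the ways of writing a fixed
-- element of the cubic class l as a sum of elements of the classes i and j. By symmetry t takes
-- only four values A, B, C, D, with A + B + C + 1 = k = B + C + D; counting the solutions of
-- a + b = c + d with a, b of class 0 and c, d of class 1 in two ways gives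
-- k + AB + AC + BC = B² + C² + D². For k ≥ 6, which excludes p = 7 and p = 13, these relations force
-- all four values to be positive: weighted sums of two units reach every nonzero residue, hence
-- those of three units reach every residue. For a prime q ≡ 2 (mod 3) every unit is a cube, and two
-- units reach every residue.
--
-- Call a prime p₀ ∣ n satisfied by a sequence if the number of terms not divisible by p₀ is zero or
-- at least d + 1, where d = 2 or d = 1 according to the class of p₀ mod 3. From a sequence of length
-- n + 2r + s discard, for one unsatisfied prime after another, its at most d units; all primes
-- become satisfied and n terms remain. Keep d + 1 units for each prime that has units, fill up to n
-- terms, and glue the local cubes by the Chinese remainder theorem. Conversely, sequences of length
-- d without zero-sum subsequence, (1) or (1, g) with g a noncube, are combined into one of length
-- 2r + s modulo n, and n - 1 zeros appended to it. Appending n - 1 zeros also deduces the upper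
-- bound for D from that for E.

module Submission where

open import Defs
open import Algebra.Bundles using (CommutativeRing)
open import Algebra.Core using (Op₁; Op₂)
open import Algebra.Structures using (IsCommutativeRing)
import Algebra.Properties.CommutativeMonoid.Sum
import Algebra.Properties.CommutativeSemiring.Exp
import Algebra.Properties.Ring
import Algebra.Properties.Semiring.Exp
import Algebra.Properties.Semiring.Mult.TCOptimised
import Algebra.Properties.Semiring.Sum
import Algebra.Solver.Ring
import Algebra.Solver.Ring.AlmostCommutativeRing as ACR
open import Data.Bool.Base using (if_then_else_)
open import Data.Fin.Base as Fin using (Fin; zero; suc; toℕ; punchIn)
open import Data.Fin.Permutation as Perm using (Permutation; permutation; _⟨$⟩ʳ_)
import Data.Fin.Properties as Fin
open import Data.Integer.Base as ℤ using (ℤ; -[1+_]; _⊖_) renaming (+_ to pos)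
import Data.Integer.Properties as ℤ
open import Data.List using (List; []; _∷_; [_]; length; _++_; filter; map; replicate; take)
open import Data.List.Membership.Propositional using (find)
open import Data.List.Membership.Propositional.Properties using (∈-∃++)
import Data.List.Properties as List
open import Data.List.Relation.Binary.Sublist.Propositional using (_⊆_; []; _∷_; _∷ʳ_; ⊆-refl; ⊆-trans; minimum)
import Data.List.Relation.Binary.Sublist.Propositional.Properties as Sublist
open import Data.List.Relation.Unary.All as All using (All; []; _∷_)
import Data.List.Relation.Unary.All.Properties as All
open import Data.List.Relation.Unary.AllPairs using ([]; _∷_)
open import Data.List.Relation.Unary.Unique.Propositional using (Unique)
open import Data.Maybe.Base using (Maybe; just; nothing)
open import Data.Nat as ℕ using (ℕ; zero; suc; z≤n; s≤s; NonZero)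
open import Data.Nat.Coprimality as Coprime using (Coprime)
open import Data.Nat.Divisibility
open import Data.Nat.DivMod using (_%_; _/_; _mod_; m%n<n; m<n⇒m%n≡m; n%n≡0; m*n%n≡0; m%n%n≡m%n; [m+kn]%n≡m%n; m≡m%n+[m/n]*n; %-distribˡ-+; %-distribˡ-*)
open import Data.Nat.GCD using (module Bézout)
open import Data.Nat.ListAction using (product; sum)
open import Data.Nat.ListAction.Properties using (sum-++; product-++; ∈⇒∣product)
open import Data.Nat.Primality using (Prime; prime⇒irreducible; prime⇒nonZero; prime⇒nonTrivial; productOfPrimes≢0; prime[2]; ¬prime[0]; ¬prime[1])
open import Data.Nat.Primality.Factorisation using (factorisationHasAllPrimeFactors)
import Data.Nat.Properties as ℕ
open import Data.Nat.Tactic.RingSolver using (solve-∀)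
open import Data.Product using (∃; ∃₂; _×_; _,_; proj₁; proj₂)
open import Data.Sum as Sum using (_⊎_; inj₁; inj₂; [_,_]′)
open import Function using (_∘_)
open import Function.Definitions using (Injective)
open import Level using (0ℓ)
open import Relation.Binary.PropositionalEquality using (_≡_; _≢_; refl; sym; trans; cong; cong₂; subst; subst₂; isEquivalence; module ≡-Reasoning)
open import Relation.Nullary using (¬_; Dec; yes; no; does; contradiction; ¬?; _⊎-dec_)
open import Relation.Unary using (Decidable)

module ℕ-Sum = Algebra.Properties.Semiring.Sum ℕ.+-*-semiring

-- Finite fields

-- Integer coefficients have decidable equality and map to every commutative ring, so opposite terms
-- cancel without any computation in the ring itself.
module IntegerSolver {c ℓ} (R : CommutativeRing c ℓ) where
  open CommutativeRing R renaming (refl to ≈-refl; sym to ≈-sym; trans to ≈-trans)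
  open Algebra.Properties.Semiring.Mult.TCOptimised semiring using (1+×; ×-homo-+; ×1-homo-*) renaming (_×_ to _·_)
  open Algebra.Properties.Ring ring
  import Relation.Binary.Reasoning.Setoid setoid as ≈-Reasoning

  ⟦_⟧ℤ : ℤ → Carrier
  ⟦ pos n ⟧ℤ      = n · 1#
  ⟦ -[1+ n ] ⟧ℤ = - (suc n · 1#)

  private
    ⊖-homo : ∀ m n → ⟦ m ⊖ n ⟧ℤ ≈ m · 1# - n · 1#
    ⊖-homo m zero = ≈-sym (≈-trans (+-congˡ -0#≈0#) (+-identityʳ _))
    ⊖-homo zero (suc n) = ≈-sym (+-identityˡ _)
    ⊖-homo (suc m) (suc n) = begin
      ⟦ suc m ⊖ suc n ⟧ℤ                    ≡⟨ cong ⟦_⟧ℤ (ℤ.[1+m]⊖[1+n]≡m⊖n m n) ⟩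
      ⟦ m ⊖ n ⟧ℤ                            ≈⟨ ⊖-homo m n ⟩
      m · 1# - n · 1#                       ≈⟨ +-congʳ (+-identityʳ _) ⟨
      m · 1# + 0# - n · 1#                  ≈⟨ +-congʳ (+-congˡ (-‿inverseʳ 1#)) ⟨
      m · 1# + (1# - 1#) - n · 1#           ≈⟨ +-congʳ (≈-trans (≈-sym (+-assoc _ _ _)) (+-congʳ (+-comm _ _))) ⟩
      1# + m · 1# - 1# - n · 1#             ≈⟨ +-assoc _ _ _ ⟩
      1# + m · 1# + (- 1# - n · 1#)         ≈⟨ +-cong (≈-sym (1+× m 1#)) (≈-trans (-‿+-comm _ _) (-‿cong (≈-sym (1+× n 1#)))) ⟩
      suc m · 1# - suc n · 1#               ∎
      where open ≈-Reasoning

    +-homo : ∀ i j → ⟦ i ℤ.+ j ⟧ℤ ≈ ⟦ i ⟧ℤ + ⟦ j ⟧ℤ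
    +-homo (pos m) (pos n) = ×-homo-+ 1# m n
    +-homo (pos m) -[1+ n ] = ⊖-homo m (suc n)
    +-homo -[1+ m ] (pos n) = ≈-trans (⊖-homo n (suc m)) (+-comm _ _)
    +-homo -[1+ m ] -[1+ n ] = begin
      - (suc (suc (m ℕ.+ n)) · 1#)        ≡⟨ cong (λ k → - (k · 1#)) (ℕ.+-suc (suc m) n) ⟨
      - ((suc m ℕ.+ suc n) · 1#)          ≈⟨ -‿cong (×-homo-+ 1# (suc m) (suc n)) ⟩
      - (suc m · 1# + suc n · 1#)         ≈⟨ -‿+-comm _ _ ⟨
      - (suc m · 1#) - (suc n · 1#)       ∎
      where open ≈-Reasoning

    -‿homo : ∀ i → ⟦ ℤ.- i ⟧ℤ ≈ - ⟦ i ⟧ℤ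
    -‿homo (pos zero)  = ≈-sym -0#≈0#
    -‿homo (pos (suc n)) = ≈-refl
    -‿homo -[1+ n ]  = ≈-sym (-‿involutive _)

    *-homo⁺ : ∀ m j → ⟦ pos m ℤ.* j ⟧ℤ ≈ ⟦ pos m ⟧ℤ * ⟦ j ⟧ℤ
    *-homo⁺ m (pos n) = ≈-trans (reflexive (cong ⟦_⟧ℤ (sym (ℤ.pos-* m n)))) (×1-homo-* m n)
    *-homo⁺ m -[1+ n ] = begin
      ⟦ pos m ℤ.* -[1+ n ] ⟧ℤ              ≡⟨ cong ⟦_⟧ℤ (ℤ.neg-distribʳ-* (pos m) (pos (suc n))) ⟨
      ⟦ ℤ.- (pos m ℤ.* pos (suc n)) ⟧ℤ         ≈⟨ -‿homo (pos m ℤ.* pos (suc n)) ⟩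
      - ⟦ pos m ℤ.* pos (suc n) ⟧ℤ             ≈⟨ -‿cong (*-homo⁺ m (pos (suc n))) ⟩
      - (m · 1# * suc n · 1#)            ≈⟨ -‿distribʳ-* _ _ ⟩
      m · 1# * - (suc n · 1#)            ∎
      where open ≈-Reasoning

    *-homo : ∀ i j → ⟦ i ℤ.* j ⟧ℤ ≈ ⟦ i ⟧ℤ * ⟦ j ⟧ℤ
    *-homo (pos m) j = *-homo⁺ m j
    *-homo -[1+ m ] j = begin
      ⟦ -[1+ m ] ℤ.* j ⟧ℤ                ≡⟨ cong ⟦_⟧ℤ (ℤ.neg-distribˡ-* (pos (suc m)) j) ⟨
      ⟦ ℤ.- (pos (suc m) ℤ.* j) ⟧ℤ           ≈⟨ -‿homo (pos (suc m) ℤ.* j) ⟩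
      - ⟦ pos (suc m) ℤ.* j ⟧ℤ               ≈⟨ -‿cong (*-homo⁺ (suc m) j) ⟩
      - (suc m · 1# * ⟦ j ⟧ℤ)            ≈⟨ -‿distribˡ-* _ _ ⟩
      - (suc m · 1#) * ⟦ j ⟧ℤ            ∎
      where open ≈-Reasoning

    coefficients : ℤ.+-*-rawRing ACR.-Raw-AlmostCommutative⟶ ACR.fromCommutativeRing R
    coefficients = record
      { ⟦_⟧    = ⟦_⟧ℤ
      ; +-homo = +-homo
      ; *-homo = *-homo
      ; -‿homo = -‿homo
      ; 0-homo = ≈-refl
      ; 1-homo = ≈-refl
      }

    _coeff≟_ : ∀ i j → Maybe (⟦ i ⟧ℤ ≈ ⟦ j ⟧ℤ)
    i coeff≟ j with i ℤ.≟ j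
    ... | yes i≡j = just (reflexive (cong ⟦_⟧ℤ i≡j))
    ... | no  _   = nothing

  open Algebra.Solver.Ring _ _ coefficients _coeff≟_ public using (solve; con; _:+_; _:*_; _:-_; :-_; _:=_)

-- The zero of the field is literally `zero`, so the nonzero elements are the `suc i`, and there are
-- `m` of them.
record FiniteField (m : ℕ) : Set where
  infixl 7 _*_
  infixl 6 _+_
  infix  8 -_
  field
    _+_ _*_           : Op₂ (Fin (suc m))
    -_                : Op₁ (Fin (suc m))
    1#                : Fin (suc m)
    isCommutativeRing : IsCommutativeRing _≡_ _+_ _*_ -_ zero 1#
    1≢0               : 1# ≢ zero
    inverse           : ∀ {x} → x ≢ zero → ∃ λ y → y * x ≡ 1#

  F : Set
  F = Fin (suc m)

  commutativeRing : CommutativeRing 0ℓ 0ℓ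
  commutativeRing = record { isCommutativeRing = isCommutativeRing }

module FieldProperties {m : ℕ} (K : FiniteField m) where
  open FiniteField K public using (F; 1#; 1≢0; inverse; commutativeRing)
  open CommutativeRing commutativeRing public
    using (_+_; _*_; -_; _-_; 0#; +-identityˡ; +-identityʳ; +-assoc; +-comm; *-identityˡ; *-identityʳ; *-assoc; *-comm;
           zeroˡ; zeroʳ; distribˡ; distribʳ; -‿inverseˡ; -‿inverseʳ; commutativeSemiring; semiring; ring; *-commutativeMonoid)
  open Algebra.Properties.Semiring.Exp semiring public using (_^_; ^-homo-*; ^-assocʳ)
  open Algebra.Properties.CommutativeSemiring.Exp commutativeSemiring public using (^-distrib-*)
  open Algebra.Properties.Ring ring public using (x∙y⁻¹≈ε⇒x≈y; x[y-z]≈xy-xz; +-inverseʳ-unique)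
  open IntegerSolver commutativeRing public

  *-cancel-≢0 : ∀ {x y z} → x ≢ 0# → x * y ≡ x * z → y ≡ z
  *-cancel-≢0 {x} {y} {z} x≢0 eq with inverse x≢0
  ... | x⁻¹ , inv = begin
    y              ≡⟨ *-identityˡ y ⟨
    1# * y         ≡⟨ cong (_* y) inv ⟨
    x⁻¹ * x * y    ≡⟨ *-assoc x⁻¹ x y ⟩
    x⁻¹ * (x * y)  ≡⟨ cong (x⁻¹ *_) eq ⟩
    x⁻¹ * (x * z)  ≡⟨ *-assoc x⁻¹ x z ⟨
    x⁻¹ * x * z    ≡⟨ cong (_* z) inv ⟩
    1# * z         ≡⟨ *-identityˡ z ⟩
    z              ∎
    where open ≡-Reasoning

  x*y≢0 : ∀ {x y} → x ≢ 0# → y ≢ 0# → x * y ≢ 0#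
  x*y≢0 {x} x≢0 y≢0 eq = y≢0 (*-cancel-≢0 x≢0 (trans eq (sym (zeroʳ x))))

  x*y≡0⇒x≡0∨y≡0 : ∀ x y → x * y ≡ 0# → x ≡ 0# ⊎ y ≡ 0#
  x*y≡0⇒x≡0∨y≡0 x y eq with x Fin.≟ 0#
  ... | yes x≡0 = inj₁ x≡0
  ... | no  x≢0 = inj₂ (*-cancel-≢0 x≢0 (trans eq (sym (zeroʳ x))))

  x^n≢0 : ∀ {x} n → x ≢ 0# → x ^ n ≢ 0#
  x^n≢0 zero    x≢0 = 1≢0
  x^n≢0 (suc n) x≢0 = x*y≢0 x≢0 (x^n≢0 n x≢0)

  0^n≡0 : ∀ n {{_ : NonZero n}} → 0# ^ n ≡ 0#
  0^n≡0 (suc n) = zeroˡ (0# ^ n)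

  -x≢0 : ∀ {x} → x ≢ 0# → - x ≢ 0#
  -x≢0 {x} x≢0 eq = x≢0 (trans (sym (+-identityʳ x)) (trans (cong (x +_) (sym eq)) (-‿inverseʳ x)))

  factor≢0 : ∀ {x y z} → z ≢ 0# → x * y ≡ z → x ≢ 0#
  factor≢0 {y = y} z≢0 eq refl = z≢0 (trans (sym eq) (zeroˡ y))

  x+[y-x]≡y : ∀ x y → x + (y - x) ≡ y
  x+[y-x]≡y = solve 2 (λ x y → x :+ (y :- x) := y) refl

  -- The list holds the lower coefficients, constant term first, of a monic polynomial.
  evalMonic : List F → F → F
  evalMonic []       x = 1#
  evalMonic (c ∷ cs) x = c + x * evalMonic cs x

  -- Synthetic division: the Horner values at `a` of the tails of the coefficient list are the
  -- coefficients of the quotient.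
  divideMonic : ∀ c cs a → ∃ λ q → length q ≡ length cs ×
    (∀ x → evalMonic (c ∷ cs) x - evalMonic (c ∷ cs) a ≡ (x - a) * evalMonic q x)
  divideMonic c [] a = [] , refl , λ x →
    solve 3 (λ c x a → (c :+ x :* con (pos 1)) :- (c :+ a :* con (pos 1)) := (x :- a) :* con (pos 1)) refl c x a
  divideMonic c (d ∷ ds) a with divideMonic d ds a
  ... | q , len , eq = evalMonic (d ∷ ds) a ∷ q , cong suc len , λ x → begin
    (c + x * E x) - (c + a * E a)
      ≡⟨ solve 5 (λ c x ex a ea → (c :+ x :* ex) :- (c :+ a :* ea) := x :* (ex :- ea) :+ (x :- a) :* ea) refl c x (E x) a (E a) ⟩
    x * (E x - E a) + (x - a) * E a
      ≡⟨ cong (λ y → x * y + (x - a) * E a) (eq x) ⟩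
    x * ((x - a) * evalMonic q x) + (x - a) * E a
      ≡⟨ solve 4 (λ x xa qx ea → x :* (xa :* qx) :+ xa :* ea := xa :* (ea :+ x :* qx)) refl x (x - a) (evalMonic q x) (E a) ⟩
    (x - a) * (E a + x * evalMonic q x) ∎
    where
    open ≡-Reasoning
    E = evalMonic (d ∷ ds)

  -- The first root splits off a linear factor. The other roots differ from it, so they are roots of
  -- the quotient; in degree zero the polynomial is 1.
  degree<roots⇒⊥ : ∀ {d} cs → length cs ≡ d → (roots : Fin (suc d) → F) → Injective _≡_ _≡_ roots →
    ¬ (∀ i → evalMonic cs (roots i) ≡ 0#)
  degree<roots⇒⊥ {zero} [] eq roots inj isRoot = 1≢0 (isRoot zero)
  degree<roots⇒⊥ {suc d} (c ∷ cs) eqd roots inj isRoot with divideMonic c cs (roots zero)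
  ... | q , len , eq = degree<roots⇒⊥ q (trans len (ℕ.suc-injective eqd)) (roots ∘ suc) (Fin.suc-injective ∘ inj) isRoot′
    where
    isRoot′ : ∀ i → evalMonic q (roots (suc i)) ≡ 0#
    isRoot′ i with x*y≡0⇒x≡0∨y≡0 _ _ (trans (sym (eq (roots (suc i)))) (trans (cong₂ _-_ (isRoot (suc i)) (isRoot zero)) (-‿inverseʳ 0#)))
    ... | inj₂ e = e
    ... | inj₁ e with inj (x∙y⁻¹≈ε⇒x≈y _ _ e)
    ...   | ()

  *-permutation : ∀ {x} → x ≢ 0# → Permutation (suc m) (suc m)
  *-permutation {x} x≢0 = permutation (x *_) (x⁻¹ *_)
    (λ y → trans (sym (*-assoc x x⁻¹ y)) (trans (cong (_* y) (trans (*-comm x x⁻¹) inv)) (*-identityˡ y)))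
    (λ y → trans (sym (*-assoc x⁻¹ x y)) (trans (cong (_* y) inv) (*-identityˡ y)))
    where
    x⁻¹ = proj₁ (inverse x≢0)
    inv = proj₂ (inverse x≢0)

  module Π = Algebra.Properties.CommutativeMonoid.Sum *-commutativeMonoid

  private
    Π-* : ∀ {n} x (f : Fin n → F) → Π.sum (λ i → x * f i) ≡ x ^ n * Π.sum f
    Π-* {zero}  x f = sym (*-identityˡ 1#)
    Π-* {suc n} x f = trans (cong (x * f zero *_) (Π-* x (f ∘ suc)))
      (solve 4 (λ x f y z → (x :* f) :* (y :* z) := (x :* y) :* (f :* z)) refl x (f zero) (x ^ n) (Π.sum (f ∘ suc)))

    Π≢0 : ∀ {n} (f : Fin n → F) → (∀ i → f i ≢ 0#) → Π.sum f ≢ 0#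
    Π≢0 {zero}  f f≢0 = 1≢0
    Π≢0 {suc n} f f≢0 = x*y≢0 (f≢0 zero) (Π≢0 (f ∘ suc) (f≢0 ∘ suc))

  -- Multiplication by `x` permutes the nonzero elements, so multiplying their product by `x ^ m`
  -- does not change it.
  fermat : ∀ {x} → x ≢ 0# → x ^ m ≡ 1#
  fermat {x} x≢0 = *-cancel-≢0 (Π≢0 {m} suc (λ _ ())) (begin
    Π.sum suc * x ^ m                    ≡⟨ *-comm (Π.sum suc) (x ^ m) ⟩
    x ^ m * Π.sum suc                    ≡⟨ Π-* x suc ⟨
    -- The permutation fixes `zero`; with that point removed it permutes the nonzero elements.
    Π.sum (λ i → x * suc i)              ≡⟨ Π.sum-cong-≗ (λ i → trans (Perm.punchIn-permute π zero i) (cong (λ z → punchIn z (Perm.remove zero π ⟨$⟩ʳ i)) (zeroʳ x))) ⟩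
    Π.sum (λ i → suc (Perm.remove zero π ⟨$⟩ʳ i)) ≡⟨ Π.sum-permute suc (Perm.remove zero π) ⟨
    Π.sum suc                            ≡⟨ *-identityʳ _ ⟨
    Π.sum suc * 1#                       ∎)
    where
    open ≡-Reasoning
    π = *-permutation x≢0

-- Sums over a finite field

indicator : ∀ {P : Set} → Dec P → ℕ
indicator P? = if does P? then 1 else 0

indicator-yes : ∀ {P : Set} (P? : Dec P) → P → indicator P? ≡ 1
indicator-yes (yes _) p = refl
indicator-yes (no ¬p) p = contradiction p ¬p

indicator-no : ∀ {P : Set} (P? : Dec P) → ¬ P → indicator P? ≡ 0
indicator-no (yes p) ¬p = contradiction p ¬p
indicator-no (no _)  ¬p = refl

indicator-cong : ∀ {P Q : Set} (P? : Dec P) (Q? : Dec Q) → (P → Q) → (Q → P) → indicator P? ≡ indicator Q?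
indicator-cong P? (yes q) to from = indicator-yes P? (from q)
indicator-cong P? (no ¬q) to from = indicator-no P? (¬q ∘ to)

indicator≢0 : ∀ {P : Set} (P? : Dec P) → indicator P? ≢ 0 → P
indicator≢0 (yes p) _  = p
indicator≢0 (no _)  ≢0 = contradiction refl ≢0

δ : ∀ {n} → Fin n → Fin n → ℕ
δ i j = indicator (i Fin.≟ j)

-- Opaque, since unfolding a sum over Fin (suc n) blocks the inference of the summand.
opaque
  ∑ : ∀ {n} → (Fin n → ℕ) → ℕ
  ∑ = ℕ-Sum.sum

  ∑-cong : ∀ {n} {f g : Fin n → ℕ} → (∀ i → f i ≡ g i) → ∑ f ≡ ∑ g
  ∑-cong = ℕ-Sum.sum-cong-≗

  ∑-+ : ∀ {n} (f g : Fin n → ℕ) → ∑ (λ i → f i ℕ.+ g i) ≡ ∑ f ℕ.+ ∑ g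
  ∑-+ = ℕ-Sum.∑-distrib-+

  ∑-comm : ∀ {m n} (f : Fin m → Fin n → ℕ) → ∑ (λ i → ∑ λ j → f i j) ≡ ∑ (λ j → ∑ λ i → f i j)
  ∑-comm = ℕ-Sum.∑-comm

  *-∑ : ∀ {n} c (f : Fin n → ℕ) → c ℕ.* ∑ f ≡ ∑ (λ i → c ℕ.* f i)
  *-∑ = ℕ-Sum.*-distribˡ-sum

  ∑-* : ∀ {n} c (f : Fin n → ℕ) → ∑ f ℕ.* c ≡ ∑ (λ i → f i ℕ.* c)
  ∑-* = ℕ-Sum.*-distribʳ-sum

  ∑-permute : ∀ {n} (f : Fin n → ℕ) (π : Permutation n n) → ∑ f ≡ ∑ (λ i → f (π ⟨$⟩ʳ i))
  ∑-permute = ℕ-Sum.sum-permute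

  ∑-0 : ∀ {n} (f : Fin n → ℕ) → (∀ i → f i ≡ 0) → ∑ f ≡ 0
  ∑-0 {n} f f≡0 = trans (ℕ-Sum.sum-cong-≗ f≡0) (ℕ-Sum.sum-replicate-zero n)

  ∑-suc : ∀ {n} (f : Fin (suc n) → ℕ) → ∑ f ≡ f zero ℕ.+ ∑ (f ∘ suc)
  ∑-suc f = refl

  ∑-1 : ∀ n → ∑ {n} (λ _ → 1) ≡ n
  ∑-1 zero    = refl
  ∑-1 (suc n) = cong suc (∑-1 n)

  ∑-mono : ∀ {n} {f g : Fin n → ℕ} → (∀ i → f i ℕ.≤ g i) → ∑ f ℕ.≤ ∑ g
  ∑-mono {zero}  f≤g = z≤n
  ∑-mono {suc n} f≤g = ℕ.+-mono-≤ (f≤g zero) (∑-mono (f≤g ∘ suc))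

  ∑-δ : ∀ {n} (i : Fin n) (f : Fin n → ℕ) → ∑ (λ j → δ i j ℕ.* f j) ≡ f i
  ∑-δ {suc n} i f = begin
    ∑ (λ j → δ i j ℕ.* f j)                                           ≡⟨ ℕ-Sum.sum-remove {i = i} (λ j → δ i j ℕ.* f j) ⟩
    δ i i ℕ.* f i ℕ.+ ∑ (λ j → δ i (punchIn i j) ℕ.* f (punchIn i j))
      ≡⟨ cong₂ ℕ._+_ (cong (ℕ._* f i) (indicator-yes (i Fin.≟ i) refl))
           (∑-0 _ λ j → cong (ℕ._* f (punchIn i j)) (indicator-no (i Fin.≟ punchIn i j) (Fin.punchInᵢ≢i i j ∘ sym))) ⟩
    1 ℕ.* f i ℕ.+ 0                                                   ≡⟨ trans (ℕ.+-identityʳ _) (ℕ.*-identityˡ _) ⟩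
    f i                                                               ∎
    where open ≡-Reasoning

∑-positive : ∀ {n} (f : Fin n → ℕ) → ∑ f ≢ 0 → ∃ λ i → f i ≢ 0
∑-positive f ∑≢0 = Fin.¬∀⟶∃¬ _ (λ i → f i ≡ 0) (λ i → f i ℕ.≟ 0) (∑≢0 ∘ ∑-0 f)

module Convolution {m : ℕ} (K : FiniteField m) where
  open FieldProperties K

  ∑-reflect : ∀ a f → ∑ f ≡ ∑ (λ x → f (a - x))
  ∑-reflect a f = ∑-permute f (permutation (λ x → a - x) (λ x → a - x) inv inv)
    where
    inv : ∀ x → a - (a - x) ≡ x
    inv = solve 2 (λ a x → a :- (a :- x) := x) refl a

  ∑-scale : ∀ {u} → u ≢ 0# → ∀ f → ∑ f ≡ ∑ (λ x → f (u * x))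
  ∑-scale u≢0 f = ∑-permute f (*-permutation u≢0)

  conv : (F → ℕ) → (F → ℕ) → F → ℕ
  conv f g c = ∑ λ x → f x ℕ.* g (c - x)

  conv-comm : ∀ f g c → conv f g c ≡ conv g f c
  conv-comm f g c = trans (∑-reflect c _) (∑-cong λ x →
    trans (ℕ.*-comm (f (c - x)) _) (cong (λ z → g z ℕ.* f (c - x)) (solve 2 (λ c x → c :- (c :- x) := x) refl c x)))

  Even : (F → ℕ) → Set
  Even f = ∀ x → f (- x) ≡ f x

  even-minus : ∀ {f} → Even f → ∀ x y → f (x - y) ≡ f (y - x)
  even-minus {f} even x y = trans (cong f (solve 2 (λ x y → x :- y := :- (y :- x)) refl x y)) (even (y - x))

  -- Both sides add up h(c) f(x) g(c - x) over all pairs; as `g` is even, `c` and `x` may change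
  -- places.
  ∑∑-conv : ∀ f g h → Even g → ∑ (λ c → h c ℕ.* conv f g c) ≡ ∑ (λ c → f c ℕ.* conv h g c)
  ∑∑-conv f g h even = begin
    ∑ (λ c → h c ℕ.* conv f g c)                         ≡⟨ ∑-cong (λ c → *-∑ (h c) _) ⟩
    ∑ (λ c → ∑ λ x → h c ℕ.* (f x ℕ.* g (c - x)))        ≡⟨ ∑-comm _ ⟩
    ∑ (λ x → ∑ λ c → h c ℕ.* (f x ℕ.* g (c - x)))        ≡⟨ ∑-cong (λ x → ∑-cong λ c → rearrange (h c) (f x) (even-minus even c x)) ⟩
    ∑ (λ x → ∑ λ c → f x ℕ.* (h c ℕ.* g (x - c)))        ≡⟨ ∑-cong (λ x → *-∑ (f x) _) ⟨
    ∑ (λ c → f c ℕ.* conv h g c)                         ∎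
    where
    open ≡-Reasoning
    rearrange : ∀ a b {c d} → c ≡ d → a ℕ.* (b ℕ.* c) ≡ b ℕ.* (a ℕ.* d)
    rearrange a b {c} refl = lemma a b c
      where
      lemma : ∀ a b c → a ℕ.* (b ℕ.* c) ≡ b ℕ.* (a ℕ.* c)
      lemma = solve-∀

  private
    ∑-conv-conv : ∀ f₁ f₂ f₃ f₄ → ∑ (λ c → conv f₁ f₂ c ℕ.* conv f₃ f₄ c) ≡
      ∑ (λ x → ∑ λ c → ∑ λ y → f₁ x ℕ.* f₂ (c - x) ℕ.* (f₃ y ℕ.* f₄ (c - y)))
    ∑-conv-conv f₁ f₂ f₃ f₄ = begin
      ∑ (λ c → conv f₁ f₂ c ℕ.* conv f₃ f₄ c)
        ≡⟨ ∑-cong (λ c → ∑-* (conv f₃ f₄ c) _) ⟩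
      ∑ (λ c → ∑ λ x → f₁ x ℕ.* f₂ (c - x) ℕ.* conv f₃ f₄ c)
        ≡⟨ ∑-cong (λ c → ∑-cong λ x → *-∑ (f₁ x ℕ.* f₂ (c - x)) _) ⟩
      ∑ (λ c → ∑ λ x → ∑ λ y → f₁ x ℕ.* f₂ (c - x) ℕ.* (f₃ y ℕ.* f₄ (c - y)))
        ≡⟨ ∑-comm _ ⟩
      ∑ (λ x → ∑ λ c → ∑ λ y → f₁ x ℕ.* f₂ (c - x) ℕ.* (f₃ y ℕ.* f₄ (c - y))) ∎
      where open ≡-Reasoning

  -- x₁ + x₂ = x₃ + x₄ is the same as x₁ - x₃ = x₄ - x₂.
  ∑-conv-swap : ∀ f₁ f₂ f₃ f₄ → Even f₂ → Even f₃ →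
    ∑ (λ c → conv f₁ f₂ c ℕ.* conv f₃ f₄ c) ≡ ∑ (λ c → conv f₁ f₃ c ℕ.* conv f₂ f₄ c)
  ∑-conv-swap f₁ f₂ f₃ f₄ even₂ even₃ = trans (∑-conv-conv f₁ f₂ f₃ f₄) (trans (∑-cong inner) (sym (∑-conv-conv f₁ f₃ f₂ f₄)))
    where
    open ≡-Reasoning
    rearrange : ∀ a {b b′ c c′ d d′} → b ≡ b′ → c ≡ c′ → d ≡ d′ → a ℕ.* b ℕ.* (c ℕ.* d) ≡ a ℕ.* c′ ℕ.* (b′ ℕ.* d′)
    rearrange a {b} {_} {c} {_} {d} refl refl refl = lemma a b c d
      where
      lemma : ∀ a b c d → a ℕ.* b ℕ.* (c ℕ.* d) ≡ a ℕ.* c ℕ.* (b ℕ.* d)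
      lemma = solve-∀
    inner : ∀ x → ∑ (λ c → ∑ λ y → f₁ x ℕ.* f₂ (c - x) ℕ.* (f₃ y ℕ.* f₄ (c - y))) ≡
                  ∑ (λ e → ∑ λ z → f₁ x ℕ.* f₃ (e - x) ℕ.* (f₂ z ℕ.* f₄ (e - z)))
    inner x = begin
      ∑ (λ c → ∑ λ y → f₁ x ℕ.* f₂ (c - x) ℕ.* (f₃ y ℕ.* f₄ (c - y)))
        -- For fixed `x`, the substitutions y = x - e and c = x - z turn the arguments c - x, y and
        -- c - y into - z, x - e and e - z. Evenness of `f₂` and `f₃` then adjusts the signs.
        ≡⟨ ∑-cong (λ c → ∑-reflect x _) ⟩
      ∑ (λ c → ∑ λ e → f₁ x ℕ.* f₂ (c - x) ℕ.* (f₃ (x - e) ℕ.* f₄ (c - (x - e))))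
        ≡⟨ ∑-comm _ ⟩
      ∑ (λ e → ∑ λ c → f₁ x ℕ.* f₂ (c - x) ℕ.* (f₃ (x - e) ℕ.* f₄ (c - (x - e))))
        ≡⟨ ∑-cong (λ e → ∑-reflect x _) ⟩
      ∑ (λ e → ∑ λ z → f₁ x ℕ.* f₂ ((x - z) - x) ℕ.* (f₃ (x - e) ℕ.* f₄ ((x - z) - (x - e))))
        ≡⟨ ∑-cong (λ e → ∑-cong λ z → rearrange (f₁ x)
             (trans (cong f₂ (solve 2 (λ x z → (x :- z) :- x := :- z) refl x z)) (even₂ z))
             (even-minus even₃ x e)
             (cong f₄ (solve 3 (λ x z e → (x :- z) :- (x :- e) := e :- z) refl x z e))) ⟩
      ∑ (λ e → ∑ λ z → f₁ x ℕ.* f₃ (e - x) ℕ.* (f₂ z ℕ.* f₄ (e - z))) ∎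

-- Cyclotomic numbers of order three

x²+y²≤xy+x+y⇒x+y≤4 : ∀ x y → x ℕ.* x ℕ.+ y ℕ.* y ℕ.≤ x ℕ.* y ℕ.+ (x ℕ.+ y) → x ℕ.+ y ℕ.≤ 4
x²+y²≤xy+x+y⇒x+y≤4 x y = [ ordered x y , (λ y≤x h → subst (ℕ._≤ 4) (ℕ.+-comm y x) (ordered y x y≤x
    (subst₂ ℕ._≤_ (ℕ.+-comm (x ℕ.* x) _) (cong₂ ℕ._+_ (ℕ.*-comm x y) (ℕ.+-comm x y)) h))) ]′ (ℕ.≤-total x y)
  where
  square-bound : ∀ s → s ℕ.* s ℕ.≤ 4 ℕ.* s → s ℕ.≤ 4
  square-bound zero    _ = z≤n
  square-bound (suc s) h = ℕ.*-cancelʳ-≤ (suc s) 4 (suc s) h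
  -- With y = x + e, the sum s = 2x + e satisfies s² + 3e² = 4 (x² - xy + y²) ≤ 4s.
  expand : ∀ x e → x ℕ.* x ℕ.+ (x ℕ.+ e) ℕ.* (x ℕ.+ e) ≡ x ℕ.* (x ℕ.+ e) ℕ.+ (x ℕ.* x ℕ.+ x ℕ.* e ℕ.+ e ℕ.* e)
  expand = solve-∀
  complete-square : ∀ x e → (x ℕ.+ (x ℕ.+ e)) ℕ.* (x ℕ.+ (x ℕ.+ e)) ℕ.+ 3 ℕ.* (e ℕ.* e) ≡ 4 ℕ.* (x ℕ.* x ℕ.+ x ℕ.* e ℕ.+ e ℕ.* e)
  complete-square = solve-∀
  ordered : ∀ x y → x ℕ.≤ y → x ℕ.* x ℕ.+ y ℕ.* y ℕ.≤ x ℕ.* y ℕ.+ (x ℕ.+ y) → x ℕ.+ y ℕ.≤ 4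
  ordered x y x≤y h with ℕ.m≤n⇒∃[o]m+o≡n x≤y
  ... | e , refl = square-bound _ (ℕ.≤-trans (ℕ.m≤m+n _ (3 ℕ.* (e ℕ.* e)))
    (ℕ.≤-trans (ℕ.≤-reflexive (complete-square x e)) (ℕ.*-monoʳ-≤ 4
      (ℕ.+-cancelˡ-≤ (x ℕ.* (x ℕ.+ e)) _ _ (ℕ.≤-trans (ℕ.≤-reflexive (sym (expand x e))) h)))))

-- The linear relations give D = A + 1 and A + B + C ≥ 5. If one of A, B, C vanishes, the quadratic
-- relation confines the other two to the region x² + y² ≤ xy + x + y, where their sum is at most 4.
cyclotomic-relations⇒positive : ∀ A B C D {k} → 6 ℕ.≤ k →
  A ℕ.+ B ℕ.+ C ℕ.+ 1 ≡ k → B ℕ.+ C ℕ.+ D ≡ k →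
  k ℕ.+ (A ℕ.* C ℕ.+ B ℕ.* A ℕ.+ C ℕ.* B) ≡ B ℕ.* B ℕ.+ C ℕ.* C ℕ.+ D ℕ.* D →
  (A ≢ 0 × B ≢ 0) × (C ≢ 0 × D ≢ 0)
cyclotomic-relations⇒positive A B C D k≥6 refl BCD≡k quadratic
  with ℕ.+-cancelˡ-≡ (B ℕ.+ C) D (suc A) (trans BCD≡k (rearrange A B C))
  where
  rearrange : ∀ A B C → A ℕ.+ B ℕ.+ C ℕ.+ 1 ≡ B ℕ.+ C ℕ.+ suc A
  rearrange = solve-∀
... | refl = (A≢0 , B≢0) , (C≢0 , λ ())
  where
  A+B+C≥5 : 5 ℕ.≤ A ℕ.+ B ℕ.+ C
  A+B+C≥5 = ℕ.+-cancelʳ-≤ 1 5 _ k≥6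
  A≢0 : A ≢ 0
  A≢0 refl = ℕ.<⇒≱ A+B+C≥5 (x²+y²≤xy+x+y⇒x+y≤4 B C (ℕ.≤-reflexive (ℕ.+-cancelʳ-≡ 1 _ _ (trans (sym quadratic) (lemma B C)))))
    where
    lemma : ∀ B C → B ℕ.+ C ℕ.+ 1 ℕ.+ (B ℕ.* 0 ℕ.+ C ℕ.* B) ≡ B ℕ.* C ℕ.+ (B ℕ.+ C) ℕ.+ 1
    lemma = solve-∀
  bound : ∀ X → A ℕ.+ X ℕ.+ 1 ℕ.+ A ℕ.* X ≡ X ℕ.* X ℕ.+ suc A ℕ.* suc A → A ℕ.+ X ℕ.≤ 4
  bound X eq = x²+y²≤xy+x+y⇒x+y≤4 A X (ℕ.+-cancelʳ-≤ (1 ℕ.+ 2 ℕ.* A) _ _ (begin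
    A ℕ.* A ℕ.+ X ℕ.* X ℕ.+ (1 ℕ.+ 2 ℕ.* A)          ≡⟨ square A X ⟩
    X ℕ.* X ℕ.+ suc A ℕ.* suc A                      ≡⟨ eq ⟨
    -- The hypothesis amounts to A² + X² = AX + X - A; adding 2A on the right makes it symmetric in
    -- `A` and `X`.
    A ℕ.+ X ℕ.+ 1 ℕ.+ A ℕ.* X                        ≤⟨ ℕ.m≤m+n _ (2 ℕ.* A) ⟩
    A ℕ.+ X ℕ.+ 1 ℕ.+ A ℕ.* X ℕ.+ 2 ℕ.* A            ≡⟨ regroup A X ⟩
    A ℕ.* X ℕ.+ (A ℕ.+ X) ℕ.+ (1 ℕ.+ 2 ℕ.* A)        ∎))
    where
    open ℕ.≤-Reasoning
    square : ∀ A X → A ℕ.* A ℕ.+ X ℕ.* X ℕ.+ (1 ℕ.+ 2 ℕ.* A) ≡ X ℕ.* X ℕ.+ suc A ℕ.* suc A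
    square = solve-∀
    regroup : ∀ A X → A ℕ.+ X ℕ.+ 1 ℕ.+ A ℕ.* X ℕ.+ 2 ℕ.* A ≡ A ℕ.* X ℕ.+ (A ℕ.+ X) ℕ.+ (1 ℕ.+ 2 ℕ.* A)
    regroup = solve-∀
  B≢0 : B ≢ 0
  B≢0 refl = ℕ.<⇒≱ (subst (5 ℕ.≤_) (cong (ℕ._+ C) (ℕ.+-identityʳ A)) A+B+C≥5) (bound C (trans (lemma A C) quadratic))
    where
    lemma : ∀ A C → A ℕ.+ C ℕ.+ 1 ℕ.+ A ℕ.* C ≡ A ℕ.+ 0 ℕ.+ C ℕ.+ 1 ℕ.+ (A ℕ.* C ℕ.+ 0 ℕ.* A ℕ.+ C ℕ.* 0)
    lemma = solve-∀
  C≢0 : C ≢ 0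
  C≢0 refl = ℕ.<⇒≱ (subst (5 ℕ.≤_) (ℕ.+-identityʳ (A ℕ.+ B)) A+B+C≥5)
    (bound B (trans (lemma A B) (trans quadratic (cong (ℕ._+ suc A ℕ.* suc A) (ℕ.+-identityʳ (B ℕ.* B))))))
    where
    lemma : ∀ A B → A ℕ.+ B ℕ.+ 1 ℕ.+ A ℕ.* B ≡ A ℕ.+ B ℕ.+ 0 ℕ.+ 1 ℕ.+ (A ℕ.* 0 ℕ.+ B ℕ.* A ℕ.+ 0 ℕ.* B)
    lemma = solve-∀

module CubeRootsOfUnity {m : ℕ} (K : FiniteField m) where
  open FieldProperties K

  private
    difference-of-cubes : ∀ w → (w - 1#) * (1# + w + w ^ 2) ≡ w ^ 3 - 1#
    difference-of-cubes = solve 1 (λ w → (w :- con (pos 1)) :* (con (pos 1) :+ w :+ w :* (w :* con (pos 1))) :=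
      w :* (w :* (w :* con (pos 1))) :- con (pos 1)) refl

    expand : ∀ y w → (y - 1#) * ((y - w) * (y - w ^ 2)) ≡ (y ^ 3 - w ^ 3) + (1# + w + w ^ 2) * (y * w - y * y)
    expand = solve 2 (λ y w → (y :- con (pos 1)) :* ((y :- w) :* (y :- w :* (w :* con (pos 1)))) :=
      (y :* (y :* (y :* con (pos 1))) :- w :* (w :* (w :* con (pos 1)))) :+ (con (pos 1) :+ w :+ w :* (w :* con (pos 1))) :* (y :* w :- y :* y)) refl

  -x≡-1*x : ∀ x → - x ≡ - 1# * x
  -x≡-1*x = solve 1 (λ x → :- x := :- con (pos 1) :* x) refl

  [-x]^3≡-[x^3] : ∀ x → (- x) ^ 3 ≡ - (x ^ 3)
  [-x]^3≡-[x^3] = solve 1 (λ x → :- x :* (:- x :* (:- x :* con (pos 1))) := :- (x :* (x :* (x :* con (pos 1))))) refl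

  -1≡[-1]^3 : - 1# ≡ (- 1#) ^ 3
  -1≡[-1]^3 = solve 0 (:- con (pos 1) := :- con (pos 1) :* (:- con (pos 1) :* (:- con (pos 1) :* con (pos 1)))) refl

  w³≡1⇒1+w+w²≡0 : ∀ {w} → w ^ 3 ≡ 1# → w ≢ 1# → 1# + w + w ^ 2 ≡ 0#
  w³≡1⇒1+w+w²≡0 {w} w³≡1 w≢1
    with x*y≡0⇒x≡0∨y≡0 _ _ (trans (difference-of-cubes w) (trans (cong (_- 1#) w³≡1) (-‿inverseʳ 1#)))
  ... | inj₁ e = contradiction (x∙y⁻¹≈ε⇒x≈y _ _ e) w≢1
  ... | inj₂ e = e

  -- By `expand`, (y - 1)(y - w)(y - w²) is y³ - w³ plus a multiple of 1 + w + w², and both parts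
  -- vanish.
  cube-roots-of-unity : ∀ {w y} → w ^ 3 ≡ 1# → w ≢ 1# → y ^ 3 ≡ 1# → y ≡ 1# ⊎ (y ≡ w ⊎ y ≡ w ^ 2)
  cube-roots-of-unity {w} {y} w³≡1 w≢1 y³≡1 with x*y≡0⇒x≡0∨y≡0 _ _ factorisation
    where
    factorisation : (y - 1#) * ((y - w) * (y - w ^ 2)) ≡ 0#
    factorisation = begin
      (y - 1#) * ((y - w) * (y - w ^ 2))                            ≡⟨ expand y w ⟩
      (y ^ 3 - w ^ 3) + (1# + w + w ^ 2) * (y * w - y * y)
        ≡⟨ cong₂ _+_ (trans (cong₂ _-_ y³≡1 w³≡1) (-‿inverseʳ 1#)) (trans (cong (_* (y * w - y * y)) (w³≡1⇒1+w+w²≡0 w³≡1 w≢1)) (zeroˡ _)) ⟩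
      0# + 0#                                                       ≡⟨ +-identityˡ 0# ⟩
      0#                                                            ∎
      where open ≡-Reasoning
  ... | inj₁ e = inj₁ (x∙y⁻¹≈ε⇒x≈y _ _ e)
  ... | inj₂ e with x*y≡0⇒x≡0∨y≡0 _ _ e
  ...   | inj₁ e₁ = inj₂ (inj₁ (x∙y⁻¹≈ε⇒x≈y _ _ e₁))
  ...   | inj₂ e₂ = inj₂ (inj₂ (x∙y⁻¹≈ε⇒x≈y _ _ e₂))

  -- The cube root is - a / b, because - 1 is its own cube. This is why (1, g) has no zero sum when
  -- g is a noncube.
  a³+b³x≡0⇒x-cube : ∀ {a b x} → a ≢ 0# → b ≢ 0# → a ^ 3 + b ^ 3 * x ≡ 0# → ∃ λ c → c ≢ 0# × c ^ 3 ≡ x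
  a³+b³x≡0⇒x-cube {a} {b} {x} a≢0 b≢0 e = c , factor≢0 (-x≢0 a≢0) c*b≡-a , *-cancel-≢0 (x^n≢0 3 b≢0) (begin
    b ^ 3 * c ^ 3      ≡⟨ *-comm (b ^ 3) (c ^ 3) ⟩
    c ^ 3 * b ^ 3      ≡⟨ ^-distrib-* c b 3 ⟨
    (c * b) ^ 3        ≡⟨ cong (_^ 3) c*b≡-a ⟩
    (- a) ^ 3          ≡⟨ [-x]^3≡-[x^3] a ⟩
    - (a ^ 3)          ≡⟨ +-inverseʳ-unique (a ^ 3) (b ^ 3 * x) e ⟨
    b ^ 3 * x          ∎)
    where
    open ≡-Reasoning
    b⁻¹ = proj₁ (inverse b≢0)
    c = - a * b⁻¹
    c*b≡-a : c * b ≡ - a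
    c*b≡-a = trans (*-assoc (- a) b⁻¹ b) (trans (cong (- a *_) (proj₂ (inverse b≢0))) (*-identityʳ (- a)))

module NonCube {m : ℕ} (K : FiniteField m) (k′ : ℕ) (m≡3k : m ≡ 3 ℕ.* suc k′) where
  open FieldProperties K

  private
    k : ℕ
    k = suc k′

  private
    evalMonic-0 : ∀ j x → evalMonic (replicate j 0#) x ≡ x ^ j
    evalMonic-0 zero    x = refl
    evalMonic-0 (suc j) x = trans (+-identityˡ _) (cong (x *_) (evalMonic-0 j x))

    k<m : suc k ℕ.≤ m
    k<m = subst (suc k ℕ.≤_) (sym m≡3k) (ℕ.≤-trans (ℕ.m≤m+n (suc k) (k′ ℕ.+ (k ℕ.+ 0))) (ℕ.≤-reflexive (lemma k′)))
      where
      lemma : ∀ k′ → suc (suc k′) ℕ.+ (k′ ℕ.+ (suc k′ ℕ.+ 0)) ≡ 3 ℕ.* suc k′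
      lemma = solve-∀

    -- Otherwise X^k - 1 would have k + 1 distinct roots among the 3k nonzero elements.
    ¬all-roots : ¬ (∀ (i : Fin m) → suc i ^ k ≡ 1#)
    ¬all-roots all-roots = degree<roots⇒⊥ {k} (- 1# ∷ replicate k′ 0#) (cong suc (List.length-replicate k′)) points
      (λ {i} {j} e → Fin.inject≤-injective k<m k<m i j (Fin.suc-injective e)) isRoot
      where
      points : Fin (suc k) → F
      points i = suc (Fin.inject≤ i k<m)
      isRoot : ∀ i → evalMonic (- 1# ∷ replicate k′ 0#) (points i) ≡ 0#
      isRoot i = trans (cong (λ z → - 1# + points i * z) (evalMonic-0 k′ (points i)))
        (trans (cong (λ z → - 1# + z) (all-roots (Fin.inject≤ i k<m))) (-‿inverseˡ 1#))

  -- Such a `g` is a noncube, since (a³)^k = a^m = 1 for every nonzero a.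
  g-exists : ∃ λ g → g ≢ 0# × g ^ k ≢ 1#
  g-exists = suc (proj₁ nonroot) , (λ ()) , proj₂ nonroot
    where
    nonroot : ∃ λ (i : Fin m) → suc i ^ k ≢ 1#
    nonroot = Fin.¬∀⟶∃¬ m (λ i → suc i ^ k ≡ 1#) (λ i → suc i ^ k Fin.≟ 1#) ¬all-roots

module CubicClasses {m : ℕ} (K : FiniteField m) (k : ℕ) {{k≢0 : NonZero k}} (m≡3k : m ≡ 3 ℕ.* k)
  (g : FiniteField.F K) (g≢0 : g ≢ zero) (g^k≢1 : FieldProperties._^_ K g k ≢ FiniteField.1# K) where
  open FieldProperties K
  open Convolution K
  open CubeRootsOfUnity K

  -- A primitive cube root of unity. For nonzero `x` the power `x ^ k` is the cubic residue
  -- character of `x`, with values among the powers of `ω`.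
  ω : F
  ω = g ^ k

  ω≢1 : ω ≢ 1#
  ω≢1 = g^k≢1

  ω^i≢0 : ∀ i → ω ^ i ≢ 0#
  ω^i≢0 i = x^n≢0 i (x^n≢0 k g≢0)

  [x^k]^3≡1 : ∀ {x} → x ≢ 0# → (x ^ k) ^ 3 ≡ 1#
  [x^k]^3≡1 {x} x≢0 = trans (^-assocʳ x k 3) (trans (cong (x ^_) (trans (ℕ.*-comm k 3) (sym m≡3k))) (fermat x≢0))

  [x^3]^k≡1 : ∀ {x} → x ≢ 0# → (x ^ 3) ^ k ≡ 1#
  [x^3]^k≡1 {x} x≢0 = trans (^-assocʳ x 3 k) (trans (cong (x ^_) (sym m≡3k)) (fermat x≢0))

  ω^3≡1 : ω ^ 3 ≡ 1#
  ω^3≡1 = [x^k]^3≡1 g≢0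

  ω^0≢ω^1 : ω ^ 0 ≢ ω ^ 1
  ω^0≢ω^1 e = ω≢1 (sym (trans e (*-identityʳ ω)))

  ω^1≢ω^2 : ω ^ 1 ≢ ω ^ 2
  ω^1≢ω^2 e = ω^0≢ω^1 (*-cancel-≢0 (x^n≢0 k g≢0) e)

  ω^2≢ω^0 : ω ^ 2 ≢ ω ^ 0
  ω^2≢ω^0 e = ω^0≢ω^1 (trans (sym ω^3≡1) (cong (ω *_) e))

  class : ∀ {x} → x ≢ 0# → ∃ λ (i : Fin 3) → x ^ k ≡ ω ^ toℕ i
  class x≢0 = [ (zero ,_) , [ (λ e → suc zero , trans e (sym (*-identityʳ ω))) , (suc (suc zero) ,_) ]′ ]′
    (cube-roots-of-unity ω^3≡1 ω≢1 ([x^k]^3≡1 x≢0))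

  -- The class index is a natural number that matters only modulo 3, so that multiplication by `g`
  -- becomes the plain shift `suc`.
  χ : ℕ → F → ℕ
  χ i x = indicator (x ^ k Fin.≟ ω ^ i)

  χ≢0⇒class : ∀ i x → χ i x ≢ 0 → x ^ k ≡ ω ^ i
  χ≢0⇒class i x = indicator≢0 (x ^ k Fin.≟ ω ^ i)

  χ-0 : ∀ i → χ i 0# ≡ 0
  χ-0 i = indicator-no (0# ^ k Fin.≟ ω ^ i) (λ e → ω^i≢0 i (trans (sym e) (0^n≡0 k)))

  χ-yes : ∀ i {x} → x ^ k ≡ ω ^ i → χ i x ≡ 1
  χ-yes i {x} = indicator-yes (x ^ k Fin.≟ ω ^ i)

  χ-no : ∀ i {j x} → x ^ k ≡ ω ^ j → ω ^ j ≢ ω ^ i → χ i x ≡ 0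
  χ-no i {j} {x} xᵏ≡ωʲ ωʲ≢ωⁱ = indicator-no (x ^ k Fin.≟ ω ^ i) (λ xᵏ≡ωⁱ → ωʲ≢ωⁱ (trans (sym xᵏ≡ωʲ) xᵏ≡ωⁱ))

  private
    χ-partition-≢0 : ∀ {x} (i : Fin 3) → x ^ k ≡ ω ^ toℕ i → χ 0 x ℕ.+ χ 1 x ℕ.+ χ 2 x ≡ 1
    χ-partition-≢0 zero             e = cong₂ ℕ._+_ (cong₂ ℕ._+_ (χ-yes 0 e) (χ-no 1 {0} e ω^0≢ω^1)) (χ-no 2 {0} e (ω^2≢ω^0 ∘ sym))
    χ-partition-≢0 (suc zero)       e = cong₂ ℕ._+_ (cong₂ ℕ._+_ (χ-no 0 {1} e (ω^0≢ω^1 ∘ sym)) (χ-yes 1 e)) (χ-no 2 {1} e ω^1≢ω^2)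
    χ-partition-≢0 (suc (suc zero)) e = cong₂ ℕ._+_ (cong₂ ℕ._+_ (χ-no 0 {2} e ω^2≢ω^0) (χ-no 1 {2} e (ω^1≢ω^2 ∘ sym))) (χ-yes 2 e)

  χ-partition : ∀ x → δ 0# x ℕ.+ (χ 0 x ℕ.+ χ 1 x ℕ.+ χ 2 x) ≡ 1
  χ-partition x = partition (0# Fin.≟ x)
    where
    partition : (0≟x : Dec (0# ≡ x)) → indicator 0≟x ℕ.+ (χ 0 x ℕ.+ χ 1 x ℕ.+ χ 2 x) ≡ 1
    partition (yes refl) = cong suc (cong₂ ℕ._+_ (cong₂ ℕ._+_ (χ-0 0) (χ-0 1)) (χ-0 2))
    partition (no 0≢x)   = χ-partition-≢0 (proj₁ (class (0≢x ∘ sym))) (proj₂ (class (0≢x ∘ sym)))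

  χ-scale : ∀ {u} l i x → u ^ k ≡ ω ^ l → χ (l ℕ.+ i) (u * x) ≡ χ i x
  χ-scale {u} l i x uᵏ = indicator-cong (_ Fin.≟ _) (_ Fin.≟ _)
    (λ e → *-cancel-≢0 (ω^i≢0 l) (trans (sym [ux]^k) (trans e (^-homo-* ω l i))))
    (λ e → trans [ux]^k (trans (cong (ω ^ l *_) e) (sym (^-homo-* ω l i))))
    where
    [ux]^k : (u * x) ^ k ≡ ω ^ l * x ^ k
    [ux]^k = trans (^-distrib-* u x k) (cong (_* x ^ k) uᵏ)

  g-class : g ^ k ≡ ω ^ 1
  g-class = sym (*-identityʳ ω)

  -- - 1 is a cube and so lies in class 0; multiplication by it preserves every class.
  χ-even : ∀ i → Even (χ i)
  χ-even i x = trans (cong (χ i) (-x≡-1*x x)) (χ-scale 0 i x [-1]^k)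
    where
    [-1]^k : (- 1#) ^ k ≡ 1#
    [-1]^k = trans (cong (_^ k) -1≡[-1]^3)
      ([x^3]^k≡1 (-x≢0 1≢0))

  ∑χ-suc : ∀ i → ∑ (χ (suc i)) ≡ ∑ (χ i)
  ∑χ-suc i = trans (∑-scale g≢0 (χ (suc i))) (∑-cong (λ x → χ-scale 1 i x g-class))

  -- Multiplication by `g` carries each class onto the next, so all three have the same size;
  -- together with zero they exhaust the 3k + 1 elements.
  ∑χ : ∀ i → ∑ (χ i) ≡ k
  ∑χ (suc i) = trans (∑χ-suc i) (∑χ i)
  ∑χ zero = ℕ.*-cancelˡ-≡ _ _ 3 (trans (cong (λ z → ∑ (χ 0) ℕ.+ z) (cong₂ (λ a b → a ℕ.+ (b ℕ.+ 0)) (sym (∑χ-suc 0)) (sym (trans (∑χ-suc 1) (∑χ-suc 0)))))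
    (trans (lemma (∑ (χ 0)) (∑ (χ 1)) (∑ (χ 2))) (trans (ℕ.suc-injective total) m≡3k)))
    where
    lemma : ∀ a b c → a ℕ.+ (b ℕ.+ (c ℕ.+ 0)) ≡ a ℕ.+ b ℕ.+ c
    lemma = solve-∀
    total : suc (∑ (χ 0) ℕ.+ ∑ (χ 1) ℕ.+ ∑ (χ 2)) ≡ suc m
    total = begin
      1 ℕ.+ (∑ (χ 0) ℕ.+ ∑ (χ 1) ℕ.+ ∑ (χ 2))
        ≡⟨ cong₂ ℕ._+_ (trans (∑-cong (λ x → sym (ℕ.*-identityʳ (δ 0# x)))) (∑-δ 0# (λ _ → 1)))
             (trans (∑-+ _ _) (cong (ℕ._+ ∑ (χ 2)) (∑-+ _ _))) ⟨
      ∑ (δ 0#) ℕ.+ ∑ (λ x → χ 0 x ℕ.+ χ 1 x ℕ.+ χ 2 x)      ≡⟨ ∑-+ _ _ ⟨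
      ∑ (λ x → δ 0# x ℕ.+ (χ 0 x ℕ.+ χ 1 x ℕ.+ χ 2 x))      ≡⟨ ∑-cong χ-partition ⟩
      ∑ {suc m} (λ _ → 1)                                    ≡⟨ ∑-1 (suc m) ⟩
      suc m                                                  ∎
      where open ≡-Reasoning

  χ*χ≡χ : ∀ i x → χ i x ℕ.* χ i x ≡ χ i x
  χ*χ≡χ i x = idempotent (x ^ k Fin.≟ ω ^ i)
    where
    idempotent : ∀ {P : Set} (P? : Dec P) → indicator P? ℕ.* indicator P? ≡ indicator P?
    idempotent (yes _) = refl
    idempotent (no _)  = refl

  -- The number of ways to write g^l as a sum of an element of class i and an element of class j.
  t : ℕ → ℕ → ℕ → ℕ
  t i j l = conv (χ i) (χ j) (g ^ l)

  conv-scale : ∀ {u} → u ≢ 0# → ∀ l i j c → u ^ k ≡ ω ^ l → conv (χ (l ℕ.+ i)) (χ (l ℕ.+ j)) (u * c) ≡ conv (χ i) (χ j) c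
  conv-scale {u} u≢0 l i j c uᵏ = trans (∑-scale u≢0 _) (∑-cong λ x → cong₂ ℕ._*_ (χ-scale l i x uᵏ)
    (trans (cong (χ (l ℕ.+ j)) (sym (x[y-z]≈xy-xz u c x))) (χ-scale l j (c - x) uᵏ)))

  [g^l]^k : ∀ l → (g ^ l) ^ k ≡ ω ^ l
  [g^l]^k l = trans (^-assocʳ g l k) (trans (cong (g ^_) (ℕ.*-comm l k)) (sym (^-assocʳ g k l)))

  same-class : ∀ {x y l} → y ≢ 0# → x ^ k ≡ ω ^ l → y ^ k ≡ ω ^ l → ∃ λ u → u * y ≡ x × u ^ k ≡ 1#
  same-class {x} {y} {l} y≢0 xᵏ yᵏ = x * y⁻¹ , u*y≡x , *-cancel-≢0 (ω^i≢0 l) (begin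
    ω ^ l * u ^ k    ≡⟨ cong (_* u ^ k) yᵏ ⟨
    y ^ k * u ^ k    ≡⟨ *-comm _ _ ⟩
    u ^ k * y ^ k    ≡⟨ ^-distrib-* u y k ⟨
    (u * y) ^ k      ≡⟨ cong (_^ k) u*y≡x ⟩
    x ^ k            ≡⟨ xᵏ ⟩
    ω ^ l            ≡⟨ *-identityʳ _ ⟨
    ω ^ l * 1#       ∎)
    where
    open ≡-Reasoning
    y⁻¹ = proj₁ (inverse y≢0)
    u = x * y⁻¹
    u*y≡x : u * y ≡ x
    u*y≡x = trans (*-assoc x y⁻¹ y) (trans (cong (x *_) (proj₂ (inverse y≢0))) (*-identityʳ x))

  class⇒≢0 : ∀ {x} l → x ^ k ≡ ω ^ l → x ≢ 0#
  class⇒≢0 l xᵏ refl = ω^i≢0 l (trans (sym xᵏ) (0^n≡0 k))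

  -- Two elements of one class differ by a factor of class 0, and scaling by such a factor preserves
  -- the classes of both summands. Hence the count depends on the class of `c` alone.
  conv-class : ∀ i j l {c} → c ^ k ≡ ω ^ l → conv (χ i) (χ j) c ≡ t i j l
  conv-class i j l {c} cᵏ = trans (cong (conv (χ i) (χ j)) (sym u*gˡ≡c)) (conv-scale (class⇒≢0 0 uᵏ≡1) 0 i j (g ^ l) uᵏ≡1)
    where
    scaling = same-class {l = l} (x^n≢0 l g≢0) cᵏ ([g^l]^k l)
    u*gˡ≡c = proj₁ (proj₂ scaling)
    uᵏ≡1 = proj₂ (proj₂ scaling)

  t-swap : ∀ i j l → t i j l ≡ t j i l
  t-swap i j l = conv-comm (χ i) (χ j) (g ^ l)

  t-period : ∀ i j → t i j 3 ≡ t i j 0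
  t-period i j = conv-class i j 0 (trans ([g^l]^k 3) ω^3≡1)

  t-shift : ∀ i j l → t (suc i) (suc j) (suc l) ≡ t i j l
  t-shift i j l = conv-scale g≢0 1 i j (g ^ l) g-class

  ∑-class : ∀ l (h : F → ℕ) n → (∀ c → c ^ k ≡ ω ^ l → h c ≡ n) → ∑ (λ c → χ l c ℕ.* h c) ≡ k ℕ.* n
  ∑-class l h n h≡n = begin
    ∑ (λ c → χ l c ℕ.* h c)  ≡⟨ ∑-cong (λ c → pointwise c (c ^ k Fin.≟ ω ^ l)) ⟩
    ∑ (λ c → χ l c ℕ.* n)    ≡⟨ ∑-* n (χ l) ⟨
    ∑ (χ l) ℕ.* n            ≡⟨ cong (ℕ._* n) (∑χ l) ⟩
    k ℕ.* n                  ∎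
    where
    open ≡-Reasoning
    pointwise : ∀ c (cᵏ : Dec (c ^ k ≡ ω ^ l)) → indicator cᵏ ℕ.* h c ≡ indicator cᵏ ℕ.* n
    pointwise c (yes cᵏ) = cong (1 ℕ.*_) (h≡n c cᵏ)
    pointwise c (no _)   = refl

  -- Multiplied by k, both sides count the solutions of c = x + y with c, x, y in the classes l, i,
  -- j: since class j is closed under negation, x = c - y is an equation of the same kind.
  t-rotate : ∀ i j l → t i j l ≡ t l j i
  t-rotate i j l = ℕ.*-cancelˡ-≡ _ _ k (begin
    k ℕ.* t i j l                              ≡⟨ ∑-class l _ _ (λ c → conv-class i j l) ⟨
    ∑ (λ c → χ l c ℕ.* conv (χ i) (χ j) c)     ≡⟨ ∑∑-conv (χ i) (χ j) (χ l) (χ-even j) ⟩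
    ∑ (λ c → χ i c ℕ.* conv (χ l) (χ j) c)     ≡⟨ ∑-class i _ _ (λ c → conv-class l j i) ⟩
    k ℕ.* t l j i                              ∎)
    where open ≡-Reasoning

  ∑-by-classes : ∀ (h : F → ℕ) (n : ℕ → ℕ) → (∀ l c → c ^ k ≡ ω ^ l → h c ≡ n l) → ∑ h ≡ h 0# ℕ.+ k ℕ.* (n 0 ℕ.+ n 1 ℕ.+ n 2)
  ∑-by-classes h n h≡n = begin
    ∑ h
      ≡⟨ ∑-cong (λ c → trans (sym (ℕ.*-identityˡ (h c))) (trans (cong (ℕ._* h c) (sym (χ-partition c))) (distribute (δ 0# c) (χ 0 c) (χ 1 c) (χ 2 c) (h c)))) ⟩
    ∑ (λ c → δ 0# c ℕ.* h c ℕ.+ (χ 0 c ℕ.* h c ℕ.+ χ 1 c ℕ.* h c ℕ.+ χ 2 c ℕ.* h c))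
      ≡⟨ trans (∑-+ _ _) (cong₂ ℕ._+_ (∑-δ 0# h) (trans (∑-+ _ _) (cong₂ ℕ._+_ (∑-+ _ _) refl))) ⟩
    h 0# ℕ.+ (∑ (λ c → χ 0 c ℕ.* h c) ℕ.+ ∑ (λ c → χ 1 c ℕ.* h c) ℕ.+ ∑ (λ c → χ 2 c ℕ.* h c))
      ≡⟨ cong (h 0# ℕ.+_) (cong₂ ℕ._+_ (cong₂ ℕ._+_ (∑-class 0 h (n 0) (h≡n 0)) (∑-class 1 h (n 1) (h≡n 1))) (∑-class 2 h (n 2) (h≡n 2))) ⟩
    h 0# ℕ.+ (k ℕ.* n 0 ℕ.+ k ℕ.* n 1 ℕ.+ k ℕ.* n 2)
      ≡⟨ cong (h 0# ℕ.+_) (factor k (n 0) (n 1) (n 2)) ⟩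
    h 0# ℕ.+ k ℕ.* (n 0 ℕ.+ n 1 ℕ.+ n 2) ∎
    where
    open ≡-Reasoning
    distribute : ∀ a b c d e → (a ℕ.+ (b ℕ.+ c ℕ.+ d)) ℕ.* e ≡ a ℕ.* e ℕ.+ (b ℕ.* e ℕ.+ c ℕ.* e ℕ.+ d ℕ.* e)
    distribute = solve-∀
    factor : ∀ k a b c → k ℕ.* a ℕ.+ k ℕ.* b ℕ.+ k ℕ.* c ≡ k ℕ.* (a ℕ.+ b ℕ.+ c)
    factor = solve-∀

  -- For each `x` of class i the difference g^l - x lies in exactly one class or is zero; the last
  -- term accounts for x = g^l.
  t-linear : ∀ i l → t i 0 l ℕ.+ t i 1 l ℕ.+ t i 2 l ℕ.+ χ i (g ^ l) ≡ k
  t-linear i l = begin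
    t i 0 l ℕ.+ t i 1 l ℕ.+ t i 2 l ℕ.+ χ i c
      ≡⟨ cong₂ ℕ._+_ (trans (∑-+ _ _) (cong (ℕ._+ t i 2 l) (∑-+ _ _))) (∑-δ c (χ i)) ⟨
    ∑ (λ x → χ i x ℕ.* χ 0 (c - x) ℕ.+ χ i x ℕ.* χ 1 (c - x) ℕ.+ χ i x ℕ.* χ 2 (c - x)) ℕ.+ ∑ (λ x → δ c x ℕ.* χ i x)
      ≡⟨ ∑-+ _ _ ⟨
    ∑ (λ x → χ i x ℕ.* χ 0 (c - x) ℕ.+ χ i x ℕ.* χ 1 (c - x) ℕ.+ χ i x ℕ.* χ 2 (c - x) ℕ.+ δ c x ℕ.* χ i x)
      ≡⟨ ∑-cong pointwise ⟩
    ∑ (χ i)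
      ≡⟨ ∑χ i ⟩
    k ∎
    where
    open ≡-Reasoning
    c = g ^ l
    collect : ∀ a b c d e → a ℕ.* b ℕ.+ a ℕ.* c ℕ.+ a ℕ.* d ℕ.+ e ℕ.* a ≡ a ℕ.* (e ℕ.+ (b ℕ.+ c ℕ.+ d))
    collect = solve-∀
    δ-shift : ∀ x → δ c x ≡ δ 0# (c - x)
    δ-shift x = indicator-cong (c Fin.≟ x) (0# Fin.≟ c - x) (λ { refl → sym (-‿inverseʳ c) }) (λ e → x∙y⁻¹≈ε⇒x≈y c x (sym e))
    pointwise : ∀ x → χ i x ℕ.* χ 0 (c - x) ℕ.+ χ i x ℕ.* χ 1 (c - x) ℕ.+ χ i x ℕ.* χ 2 (c - x) ℕ.+ δ c x ℕ.* χ i x ≡ χ i x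
    pointwise x = trans (collect (χ i x) (χ 0 (c - x)) (χ 1 (c - x)) (χ 2 (c - x)) (δ c x))
      (trans (cong (χ i x ℕ.*_) (trans (cong (ℕ._+ (χ 0 (c - x) ℕ.+ χ 1 (c - x) ℕ.+ χ 2 (c - x))) (δ-shift x)) (χ-partition (c - x)))) (ℕ.*-identityʳ (χ i x)))

  conv-0 : ∀ i j → conv (χ i) (χ j) 0# ≡ ∑ (λ x → χ i x ℕ.* χ j x)
  conv-0 i j = ∑-cong λ x → cong (χ i x ℕ.*_) (trans (cong (χ j) (+-identityˡ (- x))) (χ-even j x))

  -- The two counts are grouped by the common value c of the sums, respectively of the differences.
  -- The value c = 0 contributes k² to the first, as x pairs with - x inside one class, and nothing
  -- to the second, as distinct classes are disjoint. Each nonzero class contributes k equal terms,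
  -- and one factor k cancels.
  t-quadratic : k ℕ.+ (t 0 0 0 ℕ.* t 1 1 0 ℕ.+ t 0 0 1 ℕ.* t 1 1 1 ℕ.+ t 0 0 2 ℕ.* t 1 1 2) ≡
    t 0 1 0 ℕ.* t 0 1 0 ℕ.+ t 0 1 1 ℕ.* t 0 1 1 ℕ.+ t 0 1 2 ℕ.* t 0 1 2
  t-quadratic = ℕ.*-cancelˡ-≡ _ _ k (begin
    k ℕ.* (k ℕ.+ q₁)                                              ≡⟨ ℕ.*-distribˡ-+ k k q₁ ⟩
    k ℕ.* k ℕ.+ k ℕ.* q₁                                          ≡⟨ cong (ℕ._+ k ℕ.* q₁) (cong₂ ℕ._*_ (diagonal 0) (diagonal 1)) ⟨
    conv (χ 0) (χ 0) 0# ℕ.* conv (χ 1) (χ 1) 0# ℕ.+ k ℕ.* q₁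
      ≡⟨ ∑-by-classes (λ c → conv (χ 0) (χ 0) c ℕ.* conv (χ 1) (χ 1) c) (λ l → t 0 0 l ℕ.* t 1 1 l)
           (λ l c cᵏ → cong₂ ℕ._*_ (conv-class 0 0 l cᵏ) (conv-class 1 1 l cᵏ)) ⟨
    ∑ (λ c → conv (χ 0) (χ 0) c ℕ.* conv (χ 1) (χ 1) c)           ≡⟨ ∑-conv-swap (χ 0) (χ 0) (χ 1) (χ 1) (χ-even 0) (χ-even 1) ⟩
    ∑ (λ c → conv (χ 0) (χ 1) c ℕ.* conv (χ 0) (χ 1) c)
      ≡⟨ ∑-by-classes (λ c → conv (χ 0) (χ 1) c ℕ.* conv (χ 0) (χ 1) c) (λ l → t 0 1 l ℕ.* t 0 1 l)
           (λ l c cᵏ → cong₂ ℕ._*_ (conv-class 0 1 l cᵏ) (conv-class 0 1 l cᵏ)) ⟩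
    conv (χ 0) (χ 1) 0# ℕ.* conv (χ 0) (χ 1) 0# ℕ.+ k ℕ.* q₂      ≡⟨ cong (λ z → z ℕ.* z ℕ.+ k ℕ.* q₂) off-diagonal ⟩
    k ℕ.* q₂                                                      ∎)
    where
    open ≡-Reasoning
    q₁ = t 0 0 0 ℕ.* t 1 1 0 ℕ.+ t 0 0 1 ℕ.* t 1 1 1 ℕ.+ t 0 0 2 ℕ.* t 1 1 2
    q₂ = t 0 1 0 ℕ.* t 0 1 0 ℕ.+ t 0 1 1 ℕ.* t 0 1 1 ℕ.+ t 0 1 2 ℕ.* t 0 1 2
    diagonal : ∀ i → conv (χ i) (χ i) 0# ≡ k
    diagonal i = trans (conv-0 i i) (trans (∑-cong (χ*χ≡χ i)) (∑χ i))
    off-diagonal : conv (χ 0) (χ 1) 0# ≡ 0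
    off-diagonal = trans (conv-0 0 1) (∑-0 _ λ x → disjoint x (x ^ k Fin.≟ ω ^ 0))
      where
      disjoint : ∀ x (xᵏ : Dec (x ^ k ≡ ω ^ 0)) → indicator xᵏ ℕ.* χ 1 x ≡ 0
      disjoint x (yes xᵏ) = trans (ℕ.*-identityˡ _) (χ-no 1 {0} xᵏ ω^0≢ω^1)
      disjoint x (no _)   = refl

  private
    -- Representatives under swapping the summands, rotation, and the simultaneous shift of all
    -- three indices. The equations below carry the other values that occur in the relations to
    -- these four.
    A = t 0 0 0
    B = t 0 0 1
    C = t 0 0 2
    D = t 0 1 2

    t110≡C : t 1 1 0 ≡ C
    t110≡C = trans (sym (t-period 1 1)) (t-shift 0 0 2)
    t112≡B : t 1 1 2 ≡ B
    t112≡B = t-shift 0 0 1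
    t100≡B : t 1 0 0 ≡ B
    t100≡B = t-rotate 1 0 0
    t010≡B : t 0 1 0 ≡ B
    t010≡B = trans (t-swap 0 1 0) t100≡B
    t011≡C : t 0 1 1 ≡ C
    t011≡C = trans (t-rotate 0 1 1) t110≡C
    t200≡C : t 2 0 0 ≡ C
    t200≡C = t-rotate 2 0 0
    t020≡C : t 0 2 0 ≡ C
    t020≡C = trans (t-swap 0 2 0) t200≡C
    t220≡B : t 2 2 0 ≡ B
    t220≡B = trans (sym (t-period 2 2)) (trans (t-shift 1 1 2) t112≡B)
    t210≡D : t 2 1 0 ≡ D
    t210≡D = t-rotate 2 1 0
    t120≡D : t 1 2 0 ≡ D
    t120≡D = trans (t-swap 1 2 0) t210≡D
    t021≡D : t 0 2 1 ≡ D
    t021≡D = trans (t-swap 0 2 1) (trans (t-rotate 2 0 1) (t-swap 1 0 2))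

    -- The summand 1 appears because g^0 = 1 has class 0; in `linear₂` the target g has class 1, and
    -- the correction is 0.
    linear₁ : A ℕ.+ B ℕ.+ C ℕ.+ 1 ≡ k
    linear₁ = trans (cong₂ ℕ._+_ (cong₂ ℕ._+_ (cong (A ℕ.+_) (sym t010≡B)) (sym t020≡C)) (sym (χ-yes 0 ([g^l]^k 0)))) (t-linear 0 0)

    linear₂ : B ℕ.+ C ℕ.+ D ≡ k
    linear₂ = trans (sym (ℕ.+-identityʳ _)) (trans (cong₂ ℕ._+_ (cong₂ ℕ._+_ (cong (B ℕ.+_) (sym t011≡C)) (sym t021≡D))
      (sym (χ-no 0 {1} ([g^l]^k 1) (ω^0≢ω^1 ∘ sym)))) (t-linear 0 1))

    quadratic : k ℕ.+ (A ℕ.* C ℕ.+ B ℕ.* A ℕ.+ C ℕ.* B) ≡ B ℕ.* B ℕ.+ C ℕ.* C ℕ.+ D ℕ.* D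
    quadratic = trans (cong (k ℕ.+_) (cong₂ ℕ._+_ (cong₂ ℕ._+_ (cong (A ℕ.*_) (sym t110≡C)) (cong (B ℕ.*_) (sym (t-shift 0 0 0)))) (cong (C ℕ.*_) (sym t112≡B))))
      (trans t-quadratic (cong₂ ℕ._+_ (cong₂ ℕ._+_ (cong₂ ℕ._*_ t010≡B t010≡B) (cong₂ ℕ._*_ t011≡C t011≡C)) refl))

  t≢0 : 6 ℕ.≤ k → ∀ (i j : Fin 3) → t (toℕ i) (toℕ j) 0 ≢ 0
  t≢0 k≥6 = positive
    where
    relations = cyclotomic-relations⇒positive A B C D k≥6 linear₁ linear₂ quadratic
    A≢0 = proj₁ (proj₁ relations)
    B≢0 = proj₂ (proj₁ relations)
    C≢0 = proj₁ (proj₂ relations)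
    D≢0 = proj₂ (proj₂ relations)
    positive : ∀ (i j : Fin 3) → t (toℕ i) (toℕ j) 0 ≢ 0
    positive zero             zero             = A≢0
    positive zero             (suc zero)       = B≢0 ∘ trans (sym t010≡B)
    positive zero             (suc (suc zero)) = C≢0 ∘ trans (sym t020≡C)
    positive (suc zero)       zero             = B≢0 ∘ trans (sym t100≡B)
    positive (suc zero)       (suc zero)       = C≢0 ∘ trans (sym t110≡C)
    positive (suc zero)       (suc (suc zero)) = D≢0 ∘ trans (sym t120≡D)
    positive (suc (suc zero)) zero             = C≢0 ∘ trans (sym t200≡C)
    positive (suc (suc zero)) (suc zero)       = D≢0 ∘ trans (sym t210≡D)
    positive (suc (suc zero)) (suc (suc zero)) = B≢0 ∘ trans (sym t220≡B)

  cubeRootCount : F → ℕ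
  cubeRootCount x = ∑ λ a → indicator (a ^ 3 Fin.≟ x)

  -- If b is one cube root of `x`, every other is b times a cube root of unity: b, ωb and ω²b
  -- exhaust them.
  cubeRootCount≤3 : ∀ {b x} → b ≢ 0# → b ^ 3 ≡ x → cubeRootCount x ℕ.≤ 3
  cubeRootCount≤3 {b} {x} b≢0 b³≡x = ℕ.≤-trans (∑-mono λ a → pointwise a (a ^ 3 Fin.≟ x)) (ℕ.≤-reflexive (trans (∑-+ _ _)
    (cong₂ ℕ._+_ (trans (∑-+ _ _) (cong₂ ℕ._+_ (∑δ b) (∑δ (ω * b)))) (∑δ (ω ^ 2 * b)))))
    where
    ∑δ : ∀ c → ∑ (δ c) ≡ 1
    ∑δ c = trans (∑-cong (λ a → sym (ℕ.*-identityʳ (δ c a)))) (∑-δ c (λ _ → 1))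
    δ-yes : ∀ {c a} → c ≡ a → 1 ℕ.≤ δ c a
    δ-yes {c} {a} e = ℕ.≤-reflexive (sym (indicator-yes (c Fin.≟ a) e))
    covered : ∀ a → a ^ 3 ≡ x → 1 ℕ.≤ δ b a ℕ.+ δ (ω * b) a ℕ.+ δ (ω ^ 2 * b) a
    covered a a³≡x =
      [ (λ e → ℕ.≤-trans (δ-yes (trans (sym (*-identityˡ b)) (y≡⇒ e))) (ℕ.≤-trans (ℕ.m≤m+n _ _) (ℕ.m≤m+n _ _)))
      , [ (λ e → ℕ.≤-trans (δ-yes (y≡⇒ e)) (ℕ.≤-trans (ℕ.m≤n+m _ (δ b a)) (ℕ.m≤m+n _ _)))
        , (λ e → ℕ.≤-trans (δ-yes (y≡⇒ e)) (ℕ.m≤n+m _ (δ b a ℕ.+ δ (ω * b) a))) ]′ ]′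
      (cube-roots-of-unity ω^3≡1 ω≢1 y³≡1)
      where
      b⁻¹ = proj₁ (inverse b≢0)
      y = a * b⁻¹
      y*b≡a : y * b ≡ a
      y*b≡a = trans (*-assoc a b⁻¹ b) (trans (cong (a *_) (proj₂ (inverse b≢0))) (*-identityʳ a))
      y≡⇒ : ∀ {z} → y ≡ z → z * b ≡ a
      y≡⇒ refl = y*b≡a
      y³≡1 : y ^ 3 ≡ 1#
      y³≡1 = *-cancel-≢0 (x^n≢0 3 b≢0) (trans (*-comm (b ^ 3) (y ^ 3)) (trans (sym (^-distrib-* y b 3)) (trans (cong (_^ 3) y*b≡a) (trans a³≡x (trans (sym b³≡x) (sym (*-identityʳ (b ^ 3))))))))
    pointwise : ∀ a (a³≟x : Dec (a ^ 3 ≡ x)) → indicator a³≟x ℕ.≤ δ b a ℕ.+ δ (ω * b) a ℕ.+ δ (ω ^ 2 * b) a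
    pointwise a (yes a³≡x) = covered a a³≡x
    pointwise a (no _)     = z≤n

  -- Double counting of {a : a ≢ 0} by the value of a³: the 3k elements fall into the k fibres over
  -- class 0, of size at most 3 each, so none of these fibres is empty.
  cubeRoot : ∀ {x} → x ^ k ≡ 1# → ∃ λ a → a ^ 3 ≡ x
  cubeRoot {x} xᵏ≡1 = conclude (Fin.any? (λ a → a ^ 3 Fin.≟ x))
    where
    open ≡-Reasoning
    total : ∑ (λ c → χ 0 c ℕ.* cubeRootCount c) ≡ 3 ℕ.* k
    total = begin
      ∑ (λ c → χ 0 c ℕ.* cubeRootCount c)                            ≡⟨ ∑-cong (λ c → *-∑ (χ 0 c) _) ⟩
      ∑ (λ c → ∑ λ a → χ 0 c ℕ.* indicator (a ^ 3 Fin.≟ c))          ≡⟨ ∑-comm _ ⟩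
      ∑ (λ a → ∑ λ c → χ 0 c ℕ.* indicator (a ^ 3 Fin.≟ c))          ≡⟨ ∑-cong (λ a → trans (∑-cong λ c → ℕ.*-comm (χ 0 c) _) (∑-δ (a ^ 3) (χ 0))) ⟩
      ∑ (λ a → χ 0 (a ^ 3))                                          ≡⟨ ∑-suc _ ⟩
      χ 0 (0# ^ 3) ℕ.+ ∑ (λ (i : Fin m) → χ 0 (suc i ^ 3))           ≡⟨ cong₂ ℕ._+_ (trans (cong (χ 0) (zeroˡ (0# ^ 2))) (χ-0 0)) (∑-cong λ i → χ-yes 0 ([x^3]^k≡1 (λ ()))) ⟩
      ∑ {m} (λ _ → 1)                                                ≡⟨ trans (∑-1 m) m≡3k ⟩
      3 ℕ.* k                                                        ∎
    conclude : Dec (∃ λ a → a ^ 3 ≡ x) → ∃ λ a → a ^ 3 ≡ x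
    conclude (yes root) = root
    conclude (no ¬root) = contradiction bound (ℕ.<⇒≱ (ℕ.m<m+n (3 ℕ.* k) {3} (s≤s z≤n)))
      where
      -- Were the fibre over `x` empty, there would be room for 3 more elements at c = x; summation
      -- over c gives the absurd 3k + 3 ≤ 3k.
      pointwise : ∀ c → δ x c ℕ.* 3 ℕ.+ χ 0 c ℕ.* cubeRootCount c ℕ.≤ 3 ℕ.* χ 0 c
      pointwise c = cases (x Fin.≟ c) (c ^ k Fin.≟ ω ^ 0) (Fin.any? (λ a → a ^ 3 Fin.≟ c))
        where
        no-roots : ¬ (∃ λ a → a ^ 3 ≡ c) → cubeRootCount c ≡ 0
        no-roots ¬r = ∑-0 _ λ a → indicator-no (a ^ 3 Fin.≟ c) (λ e → ¬r (a , e))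
        cases : (x≟c : Dec (x ≡ c)) (cᵏ : Dec (c ^ k ≡ ω ^ 0)) → Dec (∃ λ a → a ^ 3 ≡ c) →
          indicator x≟c ℕ.* 3 ℕ.+ indicator cᵏ ℕ.* cubeRootCount c ℕ.≤ 3 ℕ.* indicator cᵏ
        cases (yes refl) (yes _)  _              = ℕ.≤-reflexive (cong (λ z → 3 ℕ.+ 1 ℕ.* z) (no-roots ¬root))
        cases (yes refl) (no xᵏ)  _              = contradiction xᵏ≡1 xᵏ
        cases (no _)     (yes cᵏ) (yes (a , a³)) = ℕ.≤-trans (ℕ.≤-reflexive (ℕ.*-identityˡ _))
          (cubeRootCount≤3 (λ { refl → class⇒≢0 0 cᵏ (trans (sym a³) (zeroˡ (0# ^ 2))) }) a³)
        cases (no _)     (yes _)  (no ¬r)        = ℕ.≤-trans (ℕ.≤-reflexive (cong (1 ℕ.*_) (no-roots ¬r))) z≤n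
        cases (no _)     (no _)   _              = z≤n
      bound : 3 ℕ.* k ℕ.+ 3 ℕ.≤ 3 ℕ.* k
      bound = subst₂ ℕ._≤_
        (trans (∑-+ _ _) (trans (cong₂ ℕ._+_ (∑-δ x (λ _ → 3)) total) (ℕ.+-comm 3 (3 ℕ.* k))))
        (trans (sym (*-∑ 3 (χ 0))) (cong (3 ℕ.*_) (∑χ 0)))
        (∑-mono pointwise)

  g-noncube : ∀ {a} → a ≢ 0# → a ^ 3 ≢ g
  g-noncube a≢0 refl = g^k≢1 ([x^3]^k≡1 a≢0)

  cubeRoot-≢0 : ∀ {x} → x ^ k ≡ 1# → ∃ λ a → a ≢ 0# × a ^ 3 ≡ x
  cubeRoot-≢0 {x} xᵏ with cubeRoot xᵏ
  ... | a , a³≡x = a , (λ { refl → class⇒≢0 0 xᵏ (trans (sym a³≡x) (zeroˡ (0# ^ 2))) }) , a³≡x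

  -- After division by `z` the target is 1. A positive cyclotomic number gives 1 = w + (1 - w) with
  -- w and 1 - w in the classes of x / z and y / z; the quotients within each class have class 0, so
  -- they are cubes.
  two-units-cover : 6 ℕ.≤ k → ∀ {x y z} → x ≢ 0# → y ≢ 0# → z ≢ 0# →
    ∃₂ λ a b → a ≢ 0# × b ≢ 0# × a ^ 3 * x + b ^ 3 * y ≡ z
  two-units-cover k≥6 {x} {y} {z} x≢0 y≢0 z≢0 = proj₁ a , proj₁ b , proj₁ (proj₂ a) , proj₁ (proj₂ b) , (begin
    proj₁ a ^ 3 * x + proj₁ b ^ 3 * y        ≡⟨ cong₂ _+_ (rescale x (proj₁ a) (proj₂ (proj₂ a)) (proj₁ (proj₂ u))) (rescale y (proj₁ b) (proj₂ (proj₂ b)) (proj₁ (proj₂ v))) ⟩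
    w * z + (1# - w) * z                     ≡⟨ distribʳ z w (1# - w) ⟨
    (w + (1# - w)) * z                       ≡⟨ cong (_* z) (x+[y-x]≡y w 1#) ⟩
    1# * z                                   ≡⟨ *-identityˡ z ⟩
    z                                        ∎)
    where
    open ≡-Reasoning
    z⁻¹ = proj₁ (inverse z≢0)
    z⁻¹≢0 : z⁻¹ ≢ 0#
    z⁻¹≢0 = factor≢0 1≢0 (proj₂ (inverse z≢0))
    cx = class (x*y≢0 x≢0 z⁻¹≢0)
    cy = class (x*y≢0 y≢0 z⁻¹≢0)
    i = toℕ (proj₁ cx)
    j = toℕ (proj₁ cy)
    sum-term : ∃ λ w → χ i w ℕ.* χ j (1# - w) ≢ 0
    sum-term = ∑-positive _ (t≢0 k≥6 (proj₁ cx) (proj₁ cy))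
    w = proj₁ sum-term
    wᵏ : w ^ k ≡ ω ^ i
    wᵏ = χ≢0⇒class i w (λ e → proj₂ sum-term (cong (ℕ._* χ j (1# - w)) e))
    vᵏ : (1# - w) ^ k ≡ ω ^ j
    vᵏ = χ≢0⇒class j (1# - w) (λ e → proj₂ sum-term (trans (cong (χ i w ℕ.*_) e) (ℕ.*-zeroʳ (χ i w))))
    u = same-class {l = i} (x*y≢0 x≢0 z⁻¹≢0) wᵏ (proj₂ cx)
    v = same-class {l = j} (x*y≢0 y≢0 z⁻¹≢0) vᵏ (proj₂ cy)
    a = cubeRoot-≢0 (proj₂ (proj₂ u))
    b = cubeRoot-≢0 (proj₂ (proj₂ v))
    rescale : ∀ x {s w} a → a ^ 3 ≡ s → s * (x * z⁻¹) ≡ w → a ^ 3 * x ≡ w * z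
    rescale x {w = w} a refl e = begin
      a ^ 3 * x                  ≡⟨ *-identityʳ _ ⟨
      a ^ 3 * x * 1#             ≡⟨ cong (a ^ 3 * x *_) (proj₂ (inverse z≢0)) ⟨
      a ^ 3 * x * (z⁻¹ * z)      ≡⟨ *-assoc _ z⁻¹ z ⟨
      a ^ 3 * x * z⁻¹ * z        ≡⟨ cong (_* z) (trans (*-assoc (a ^ 3) x z⁻¹) e) ⟩
      w * z                      ∎

-- Residues modulo a prime

module ResidueRing (m : ℕ) where
  private
    p = suc m
    F = Fin p

  ⟦_⟧ : ℕ → F
  ⟦ a ⟧ = a mod p

  toℕ-⟦⟧ : ∀ a → toℕ ⟦ a ⟧ ≡ a % p
  toℕ-⟦⟧ a = Fin.toℕ-fromℕ< (m%n<n a p)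

  ⟦⟧-cong : ∀ a b → a % p ≡ b % p → ⟦ a ⟧ ≡ ⟦ b ⟧
  ⟦⟧-cong a b e = Fin.toℕ-injective (trans (toℕ-⟦⟧ a) (trans e (sym (toℕ-⟦⟧ b))))

  ⟦toℕ⟧ : ∀ x → ⟦ toℕ x ⟧ ≡ x
  ⟦toℕ⟧ x = Fin.toℕ-injective (trans (toℕ-⟦⟧ (toℕ x)) (m<n⇒m%n≡m (Fin.toℕ<n x)))

  infixl 6 _+_
  infixl 7 _*_
  infix  8 -_

  _+_ _*_ : F → F → F
  x + y = ⟦ toℕ x ℕ.+ toℕ y ⟧
  x * y = ⟦ toℕ x ℕ.* toℕ y ⟧

  -_ : F → F
  - x = ⟦ p ℕ.∸ toℕ x ⟧

  ⟦⟧-+ : ∀ a b → ⟦ a ℕ.+ b ⟧ ≡ ⟦ a ⟧ + ⟦ b ⟧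
  ⟦⟧-+ a b = ⟦⟧-cong (a ℕ.+ b) (toℕ ⟦ a ⟧ ℕ.+ toℕ ⟦ b ⟧) (trans (%-distribˡ-+ a b p) (cong₂ (λ x y → (x ℕ.+ y) % p) (sym (toℕ-⟦⟧ a)) (sym (toℕ-⟦⟧ b))))

  ⟦⟧-* : ∀ a b → ⟦ a ℕ.* b ⟧ ≡ ⟦ a ⟧ * ⟦ b ⟧
  ⟦⟧-* a b = ⟦⟧-cong (a ℕ.* b) (toℕ ⟦ a ⟧ ℕ.* toℕ ⟦ b ⟧) (trans (%-distribˡ-* a b p) (cong₂ (λ x y → (x ℕ.* y) % p) (sym (toℕ-⟦⟧ a)) (sym (toℕ-⟦⟧ b))))

  private
    -- This and its multiplicative analogue remove a reduction from the left operand, so that the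
    -- ring laws follow from those of the natural numbers.
    [_]+_ : ∀ a x → ⟦ a ⟧ + x ≡ ⟦ a ℕ.+ toℕ x ⟧
    [ a ]+ x = trans (cong (⟦ a ⟧ +_) (sym (⟦toℕ⟧ x))) (sym (⟦⟧-+ a (toℕ x)))
    [_]*_ : ∀ a x → ⟦ a ⟧ * x ≡ ⟦ a ℕ.* toℕ x ⟧
    [ a ]* x = trans (cong (⟦ a ⟧ *_) (sym (⟦toℕ⟧ x))) (sym (⟦⟧-* a (toℕ x)))

    +-comm : ∀ x y → x + y ≡ y + x
    +-comm x y = cong ⟦_⟧ (ℕ.+-comm (toℕ x) (toℕ y))
    *-comm : ∀ x y → x * y ≡ y * x
    *-comm x y = cong ⟦_⟧ (ℕ.*-comm (toℕ x) (toℕ y))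
    +-assoc : ∀ x y z → (x + y) + z ≡ x + (y + z)
    +-assoc x y z = trans ([ toℕ x ℕ.+ toℕ y ]+ z) (trans (cong ⟦_⟧ (trans (ℕ.+-assoc (toℕ x) (toℕ y) (toℕ z)) (ℕ.+-comm (toℕ x) _)))
      (trans (sym ([ toℕ y ℕ.+ toℕ z ]+ x)) (+-comm (y + z) x)))
    *-assoc : ∀ x y z → (x * y) * z ≡ x * (y * z)
    *-assoc x y z = trans ([ toℕ x ℕ.* toℕ y ]* z) (trans (cong ⟦_⟧ (trans (ℕ.*-assoc (toℕ x) (toℕ y) (toℕ z)) (ℕ.*-comm (toℕ x) _)))
      (trans (sym ([ toℕ y ℕ.* toℕ z ]* x)) (*-comm (y * z) x)))
    distribʳ : ∀ x y z → (y + z) * x ≡ y * x + z * x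
    distribʳ x y z = trans ([ toℕ y ℕ.+ toℕ z ]* x) (trans (cong ⟦_⟧ (ℕ.*-distribʳ-+ (toℕ x) (toℕ y) (toℕ z))) (⟦⟧-+ (toℕ y ℕ.* toℕ x) (toℕ z ℕ.* toℕ x)))
    distribˡ : ∀ x y z → x * (y + z) ≡ x * y + x * z
    distribˡ x y z = trans (*-comm x (y + z)) (trans (distribʳ x y z) (cong₂ _+_ (*-comm y x) (*-comm z x)))
    +-identityˡ : ∀ x → zero + x ≡ x
    +-identityˡ = ⟦toℕ⟧
    *-identityˡ : ∀ x → ⟦ 1 ⟧ * x ≡ x
    *-identityˡ x = trans ([ 1 ]* x) (trans (cong ⟦_⟧ (ℕ.*-identityˡ (toℕ x))) (⟦toℕ⟧ x))
    -‿inverseˡ : ∀ x → - x + x ≡ zero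
    -‿inverseˡ x = trans ([ p ℕ.∸ toℕ x ]+ x) (⟦⟧-cong (p ℕ.∸ toℕ x ℕ.+ toℕ x) 0 (trans (cong (_% p) (ℕ.m∸n+n≡m (ℕ.<⇒≤ (Fin.toℕ<n x)))) (n%n≡0 p)))

  isCommutativeRing : IsCommutativeRing _≡_ _+_ _*_ -_ zero ⟦ 1 ⟧
  isCommutativeRing = record
    { isRing = record
      { +-isAbelianGroup = record
        { isGroup = record
          { isMonoid = record
            { isSemigroup = record
              { isMagma = record { isEquivalence = isEquivalence ; ∙-cong = cong₂ _+_ }
              ; assoc = +-assoc }
            ; identity = +-identityˡ , λ x → trans (+-comm x zero) (+-identityˡ x) }
          ; inverse = -‿inverseˡ , λ x → trans (+-comm x (- x)) (-‿inverseˡ x)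
          ; ⁻¹-cong = cong -_ }
        ; comm = +-comm }
      ; *-cong = cong₂ _*_
      ; *-assoc = *-assoc
      ; *-identity = *-identityˡ , λ x → trans (*-comm x ⟦ 1 ⟧) (*-identityˡ x)
      ; distrib = distribˡ , distribʳ }
    ; *-comm = *-comm }

  ∣⇒⟦⟧≡0 : ∀ a → p ∣ a → ⟦ a ⟧ ≡ zero
  ∣⇒⟦⟧≡0 a p∣a = ⟦⟧-cong a 0 (n∣m⇒m%n≡0 a p p∣a)

  ⟦⟧≡0⇒∣ : ∀ a → ⟦ a ⟧ ≡ zero → p ∣ a
  ⟦⟧≡0⇒∣ a e = m%n≡0⇒n∣m a p (trans (sym (toℕ-⟦⟧ a)) (cong toℕ e))

  module _ (p-prime : Prime p) where
    1≢0 : ⟦ 1 ⟧ ≢ zero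
    1≢0 e with trans (sym (m<n⇒m%n≡m (ℕ.nonTrivial⇒n>1 p {{prime⇒nonTrivial p-prime}}))) (trans (sym (toℕ-⟦⟧ 1)) (cong toℕ e))
    ... | ()

    coprime : ∀ {x : F} → x ≢ zero → Coprime p (toℕ x)
    coprime {zero}  x≢0 = contradiction refl x≢0
    coprime {suc x} _   = Coprime.prime⇒coprime p-prime (Fin.toℕ<n (suc x))

    inverse : ∀ {x} → x ≢ zero → ∃ λ y → y * x ≡ ⟦ 1 ⟧
    inverse {x} x≢0 with Coprime.coprime-Bézout (coprime x≢0)
    ... | Bézout.-+ a b eq = ⟦ b ⟧ , (begin
      ⟦ b ⟧ * x             ≡⟨ [ b ]* x ⟩
      ⟦ b ℕ.* toℕ x ⟧       ≡⟨ cong ⟦_⟧ eq ⟨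
      ⟦ 1 ℕ.+ a ℕ.* p ⟧     ≡⟨ ⟦⟧-+ 1 (a ℕ.* p) ⟩
      ⟦ 1 ⟧ + ⟦ a ℕ.* p ⟧   ≡⟨ cong (⟦ 1 ⟧ +_) (⟦⟧-cong (a ℕ.* p) 0 (m*n%n≡0 a p)) ⟩
      ⟦ 1 ⟧ + zero          ≡⟨ trans (+-comm ⟦ 1 ⟧ zero) (+-identityˡ ⟦ 1 ⟧) ⟩
      ⟦ 1 ⟧                 ∎)
      where open ≡-Reasoning
    -- Here 1 + b x = a p, so the inverse is - b; as m ≡ - 1 modulo p, it is represented by m b.
    ... | Bézout.+- a b eq = ⟦ m ℕ.* b ⟧ , (begin
      ⟦ m ℕ.* b ⟧ * x                                   ≡⟨ [ m ℕ.* b ]* x ⟩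
      ⟦ m ℕ.* b ℕ.* toℕ x ⟧                             ≡⟨ +-identityˡ _ ⟨
      zero + ⟦ m ℕ.* b ℕ.* toℕ x ⟧                      ≡⟨ cong (_+ ⟦ m ℕ.* b ℕ.* toℕ x ⟧) (⟦⟧-cong p 0 (n%n≡0 p)) ⟨
      ⟦ 1 ℕ.+ m ⟧ + ⟦ m ℕ.* b ℕ.* toℕ x ⟧               ≡⟨ ⟦⟧-+ (1 ℕ.+ m) (m ℕ.* b ℕ.* toℕ x) ⟨
      ⟦ 1 ℕ.+ m ℕ.+ m ℕ.* b ℕ.* toℕ x ⟧                 ≡⟨ cong ⟦_⟧ (cong suc (trans (cong₂ ℕ._+_ (sym (ℕ.*-identityʳ m)) (ℕ.*-assoc m b (toℕ x))) (sym (ℕ.*-distribˡ-+ m 1 (b ℕ.* toℕ x))))) ⟩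
      ⟦ 1 ℕ.+ m ℕ.* (1 ℕ.+ b ℕ.* toℕ x) ⟧               ≡⟨ ⟦⟧-+ 1 (m ℕ.* (1 ℕ.+ b ℕ.* toℕ x)) ⟩
      ⟦ 1 ⟧ + ⟦ m ℕ.* (1 ℕ.+ b ℕ.* toℕ x) ⟧             ≡⟨ cong (λ z → ⟦ 1 ⟧ + ⟦ m ℕ.* z ⟧) eq ⟩
      ⟦ 1 ⟧ + ⟦ m ℕ.* (a ℕ.* p) ⟧                       ≡⟨ cong (⟦ 1 ⟧ +_) (⟦⟧-cong (m ℕ.* (a ℕ.* p)) 0 (trans (cong (_% p) (sym (ℕ.*-assoc m a p))) (m*n%n≡0 (m ℕ.* a) p))) ⟩
      ⟦ 1 ⟧ + zero                                      ≡⟨ trans (+-comm ⟦ 1 ⟧ zero) (+-identityˡ ⟦ 1 ⟧) ⟩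
      ⟦ 1 ⟧                                             ∎)
      where open ≡-Reasoning

-- Residues are used only through this interface: the concrete operations would unfold during unification.
record ResidueField (m : ℕ) : Set where
  field
    finiteField : FiniteField m
  open FiniteField finiteField using (F; _+_; _*_; 1#)
  field
    ⟦_⟧      : ℕ → F
    ⟦toℕ⟧    : ∀ x → ⟦ toℕ x ⟧ ≡ x
    ⟦⟧-+     : ∀ a b → ⟦ a ℕ.+ b ⟧ ≡ ⟦ a ⟧ + ⟦ b ⟧
    ⟦⟧-*     : ∀ a b → ⟦ a ℕ.* b ⟧ ≡ ⟦ a ⟧ * ⟦ b ⟧
    ⟦1⟧      : ⟦ 1 ⟧ ≡ 1#
    ∣⇒⟦⟧≡0   : ∀ a → suc m ∣ a → ⟦ a ⟧ ≡ zero
    ⟦⟧≡0⇒∣   : ∀ a → ⟦ a ⟧ ≡ zero → suc m ∣ a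
    coprime  : ∀ {x : F} → x ≢ zero → Coprime (suc m) (toℕ x)

residueField : ∀ m → Prime (suc m) → ResidueField m
residueField m p-prime = record
  { finiteField = record { isCommutativeRing = isCommutativeRing ; 1≢0 = 1≢0 p-prime ; inverse = inverse p-prime }
  ; ⟦_⟧ = ⟦_⟧ ; ⟦toℕ⟧ = ⟦toℕ⟧ ; ⟦⟧-+ = ⟦⟧-+ ; ⟦⟧-* = ⟦⟧-* ; ⟦1⟧ = refl ; ∣⇒⟦⟧≡0 = ∣⇒⟦⟧≡0 ; ⟦⟧≡0⇒∣ = ⟦⟧≡0⇒∣
  ; coprime = coprime p-prime }
  where open ResidueRing m

-- Zero sums modulo a single prime

data CubeSum (n : ℕ) : List ℕ → ℕ → Set where
  []   : CubeSum n [] 0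
  cons : ∀ {x xs s} u → Coprime u n → CubeSum n xs s → CubeSum n (x ∷ xs) (u ℕ.^ 3 ℕ.* x ℕ.+ s)

-- Terms are natural numbers and weights are unreduced cubes, so one and the same sequence can be
-- examined modulo every divisor of n.
ZeroSum : ℕ → List ℕ → Set
ZeroSum n xs = ∃ λ s → CubeSum n xs s × n ∣ s

nonMultiples : ℕ → List ℕ → List ℕ
nonMultiples p = filter (λ x → ¬? (p ∣? x))

nonMultiples-∣ : ∀ {p x} xs → p ∣ x → nonMultiples p (x ∷ xs) ≡ nonMultiples p xs
nonMultiples-∣ {p} xs p∣x = List.filter-reject (λ x → ¬? (p ∣? x)) (λ p∤x → p∤x p∣x)

nonMultiples-∤ : ∀ {p x} xs → ¬ (p ∣ x) → nonMultiples p (x ∷ xs) ≡ x ∷ nonMultiples p xs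
nonMultiples-∤ {p} xs p∤x = List.filter-accept (λ x → ¬? (p ∣? x)) p∤x

-- What the argument needs to know about T_p: it has local Davenport constant d + 1.
record Local (p d : ℕ) : Set where
  field
    d>0         : 1 ℕ.≤ d
    d<p         : suc d ℕ.≤ p
    cover       : ∀ xs → suc d ℕ.≤ length (nonMultiples p xs) → ZeroSum p xs
    obstruction : List ℕ
    length≡d    : length obstruction ≡ d
    zero-free   : ∀ {ys} → ys ⊆ obstruction → ZeroSum p ys → ys ≡ []

module LocalSums {m : ℕ} (R : ResidueField m) where
  open ResidueField R public
  open FieldProperties finiteField public

  p : ℕ
  p = suc m

  -- The total enters through an equation, which permits any prescribed target and pattern matching
  -- without unifying field operations.
  data WeightedSum : List ℕ → F → Set where
    []   : WeightedSum [] 0#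
    cons : ∀ {a x xs s t} → a ≢ 0# → WeightedSum xs s → a ^ 3 * ⟦ x ⟧ + s ≡ t → WeightedSum (x ∷ xs) t

  ⟦0⟧ : ⟦ 0 ⟧ ≡ 0#
  ⟦0⟧ = ∣⇒⟦⟧≡0 0 (p ∣0)

  ⟦cube⟧ : ∀ u → ⟦ u ℕ.^ 3 ⟧ ≡ ⟦ u ⟧ ^ 3
  ⟦cube⟧ u = trans (⟦⟧-* u _) (cong (⟦ u ⟧ *_) (trans (⟦⟧-* u _) (cong (⟦ u ⟧ *_) (trans (⟦⟧-* u 1) (cong (⟦ u ⟧ *_) ⟦1⟧)))))

  ⟦cube-term⟧ : ∀ u x s → ⟦ u ℕ.^ 3 ℕ.* x ℕ.+ s ⟧ ≡ ⟦ u ⟧ ^ 3 * ⟦ x ⟧ + ⟦ s ⟧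
  ⟦cube-term⟧ u x s = trans (⟦⟧-+ (u ℕ.^ 3 ℕ.* x) s) (cong (_+ ⟦ s ⟧) (trans (⟦⟧-* (u ℕ.^ 3) x) (cong (_* ⟦ x ⟧) (⟦cube⟧ u))))

  lift : ∀ {xs t} → WeightedSum xs t → ∃ λ s → CubeSum p xs s × ⟦ s ⟧ ≡ t
  lift [] = 0 , [] , ⟦0⟧
  lift (cons {a} {x} a≢0 σ e) with lift σ
  ... | s , σ′ , e′ = _ , cons (toℕ a) (Coprime.sym (coprime a≢0)) σ′ ,
    trans (⟦cube-term⟧ (toℕ a) x s) (trans (cong₂ (λ b c → b ^ 3 * ⟦ x ⟧ + c) (⟦toℕ⟧ a) e′) e)

  coprime⇒≢0 : Prime p → ∀ {u} → Coprime u p → ⟦ u ⟧ ≢ 0#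
  coprime⇒≢0 p-prime {u} c e = ¬prime[1] (subst Prime (c (⟦⟧≡0⇒∣ u e , ∣-refl)) p-prime)

  reduce : Prime p → ∀ {xs s} → CubeSum p xs s → WeightedSum xs ⟦ s ⟧
  reduce p-prime [] = subst (WeightedSum []) (sym ⟦0⟧) []
  reduce p-prime (cons {x} {s = s} u c σ) = cons (coprime⇒≢0 p-prime c) (reduce p-prime σ) (sym (⟦cube-term⟧ u x s))

  sum⇒zeroSum : ∀ {xs} → WeightedSum xs 0# → ZeroSum p xs
  sum⇒zeroSum σ with lift σ
  ... | s , σ′ , e = s , σ′ , ⟦⟧≡0⇒∣ s e

  zeroSum⇒sum : Prime p → ∀ {xs} → ZeroSum p xs → WeightedSum xs 0#
  zeroSum⇒sum p-prime {xs} (s , σ , p∣s) = subst (WeightedSum xs) (∣⇒⟦⟧≡0 s p∣s) (reduce p-prime σ)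

  private
    cons-1 : ∀ {x xs s t} → WeightedSum xs s → ⟦ x ⟧ + s ≡ t → WeightedSum (x ∷ xs) t
    cons-1 {x} {s = s} σ e = cons 1≢0 σ (trans (cong (_+ s) (trans (cong (_* ⟦ x ⟧) 1³) (*-identityˡ ⟦ x ⟧))) e)
      where
      1³ : 1# ^ 3 ≡ 1#
      1³ = trans (*-identityˡ _) (trans (*-identityˡ _) (*-identityˡ 1#))

    cons-[-1] : ∀ {x xs s t} → WeightedSum xs s → - ⟦ x ⟧ + s ≡ t → WeightedSum (x ∷ xs) t
    cons-[-1] {x} {s = s} σ e = cons (-x≢0 1≢0) σ (trans (cong (_+ s) (trans (cong (_* ⟦ x ⟧) (sym -1≡[-1]^3)) (sym (-x≡-1*x ⟦ x ⟧)))) e)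
      where open CubeRootsOfUnity finiteField

  -- Multiples of p contribute zero under any weight; they receive the weight 1.
  insert-multiples : ∀ xs {t} → WeightedSum (nonMultiples p xs) t → WeightedSum xs t
  insert-multiples [] σ = σ
  insert-multiples (x ∷ xs) {t} σ = step (p ∣? x)
    where
    step : Dec (p ∣ x) → WeightedSum (x ∷ xs) t
    step (yes p∣x) = cons-1 (insert-multiples xs (subst (λ ys → WeightedSum ys t) (nonMultiples-∣ xs p∣x) σ))
      (trans (cong (_+ t) (∣⇒⟦⟧≡0 x p∣x)) (+-identityˡ t))
    step (no p∤x) with subst (λ ys → WeightedSum ys t) (nonMultiples-∤ xs p∤x) σ
    ... | cons a≢0 σ′ e = cons a≢0 (insert-multiples xs σ′) e

  -- The target zero has to be excluded: a single unit never reaches it, nor does the pair (1, g)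
  -- with g a noncube.
  Covers : ℕ → Set
  Covers d = ∀ xs → All (λ x → ⟦ x ⟧ ≢ 0#) xs → length xs ≡ d → ∀ {t} → t ≢ 0# → WeightedSum xs t

  -- One more unit x than needed for the nonzero targets: take its weight to be 1 or -1, so that
  -- the remaining target t - x or t + x is nonzero.
  covers⇒all-targets : ∀ {d} → Covers d → ¬ (p ∣ 2) → ∀ xs → suc d ℕ.≤ length (nonMultiples p xs) → ∀ t → WeightedSum xs t
  covers⇒all-targets {d} covers p∤2 (x ∷ xs) d<len t = step (p ∣? x)
    where
    step : Dec (p ∣ x) → WeightedSum (x ∷ xs) t
    step (yes p∣x) = cons-1 (covers⇒all-targets covers p∤2 xs (subst (λ ys → suc d ℕ.≤ length ys) (nonMultiples-∣ xs p∣x) d<len) t)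
      (trans (cong (_+ t) (∣⇒⟦⟧≡0 x p∣x)) (+-identityˡ t))
    step (no p∤x) = count (ℕ.m≤n⇒m<n∨m≡n (ℕ.s≤s⁻¹ (subst (λ ys → suc d ℕ.≤ length ys) (nonMultiples-∤ xs p∤x) d<len)))
      where
      x≢0 : ⟦ x ⟧ ≢ 0#
      x≢0 = p∤x ∘ ⟦⟧≡0⇒∣ x
      units : ∀ ys → All (λ y → ⟦ y ⟧ ≢ 0#) (nonMultiples p ys)
      units ys = All.map (λ {y} p∤y → p∤y ∘ ⟦⟧≡0⇒∣ y) (All.all-filter (λ y → ¬? (p ∣? y)) ys)
      -- For t = x the weight - 1 leaves the target 2x, which is nonzero because p does not divide
      -- 2.
      double≢0 : ⟦ x ⟧ + ⟦ x ⟧ ≢ 0#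
      double≢0 e = [ p∤2 ∘ ⟦⟧≡0⇒∣ 2 ∘ trans (trans (⟦⟧-+ 1 1) (cong₂ _+_ ⟦1⟧ ⟦1⟧)) , x≢0 ]′
        (x*y≡0⇒x≡0∨y≡0 (1# + 1#) ⟦ x ⟧ (trans (distribʳ ⟦ x ⟧ 1# 1#) (trans (cong₂ _+_ (*-identityˡ ⟦ x ⟧) (*-identityˡ ⟦ x ⟧)) e)))
      count : d ℕ.< length (nonMultiples p xs) ⊎ d ≡ length (nonMultiples p xs) → WeightedSum (x ∷ xs) t
      count (inj₁ d<len′) = cons-1 (covers⇒all-targets covers p∤2 xs d<len′ (t - ⟦ x ⟧)) (x+[y-x]≡y ⟦ x ⟧ t)
      count (inj₂ d≡len′) = sign (t Fin.≟ ⟦ x ⟧)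
        where
        rest : ∀ {s} → s ≢ 0# → WeightedSum xs s
        rest s≢0 = insert-multiples xs (covers (nonMultiples p xs) (units xs) (sym d≡len′) s≢0)
        sign : Dec (t ≡ ⟦ x ⟧) → WeightedSum (x ∷ xs) t
        sign (yes refl) = cons-[-1] (rest double≢0) (trans (sym (+-assoc (- ⟦ x ⟧) ⟦ x ⟧ ⟦ x ⟧)) (trans (cong (_+ ⟦ x ⟧) (-‿inverseˡ ⟦ x ⟧)) (+-identityˡ ⟦ x ⟧)))
        sign (no t≢x)   = cons-1 (rest (t≢x ∘ x∙y⁻¹≈ε⇒x≈y t ⟦ x ⟧)) (x+[y-x]≡y ⟦ x ⟧ t)

  private
    cons-0 : ∀ {a} x → a ^ 3 * ⟦ x ⟧ + 0# ≡ 0# → a ≢ 0# → ⟦ x ⟧ ≡ 0#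
    cons-0 {a} x e a≢0 = [ (λ a³≡0 → contradiction a³≡0 (x^n≢0 3 a≢0)) , (λ e → e) ]′ (x*y≡0⇒x≡0∨y≡0 _ _ (trans (sym (+-identityʳ _)) e))

  ¬sum-[x]≡0 : ∀ {x} → ⟦ x ⟧ ≢ 0# → ¬ WeightedSum (x ∷ []) 0#
  ¬sum-[x]≡0 {x} x≢0 (cons a≢0 [] e) = x≢0 (cons-0 x e a≢0)

  module UnitsAreCubes (p-prime : Prime p) (p∤2 : ¬ (p ∣ 2)) (j : ℕ) (m≡3j+1 : m ≡ 3 ℕ.* j ℕ.+ 1) where
    -- 3 (2j + 1) = 2m + 1
    cube-root : ∀ {x} → x ≢ 0# → (x ^ (2 ℕ.* j ℕ.+ 1)) ^ 3 ≡ x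
    cube-root {x} x≢0 = begin
      (x ^ (2 ℕ.* j ℕ.+ 1)) ^ 3      ≡⟨ ^-assocʳ x (2 ℕ.* j ℕ.+ 1) 3 ⟩
      x ^ ((2 ℕ.* j ℕ.+ 1) ℕ.* 3)    ≡⟨ cong (x ^_) (trans (lemma j) (cong (λ k → suc (k ℕ.+ k)) (sym m≡3j+1))) ⟩
      x * x ^ (m ℕ.+ m)              ≡⟨ cong (x *_) (trans (^-homo-* x m m) (trans (cong₂ _*_ (fermat x≢0) (fermat x≢0)) (*-identityˡ 1#))) ⟩
      x * 1#                         ≡⟨ *-identityʳ x ⟩
      x                              ∎
      where
      open ≡-Reasoning
      lemma : ∀ j → (2 ℕ.* j ℕ.+ 1) ℕ.* 3 ≡ suc (3 ℕ.* j ℕ.+ 1 ℕ.+ (3 ℕ.* j ℕ.+ 1))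
      lemma = solve-∀

    covers : Covers 1
    covers (x ∷ []) (x≢0 ∷ []) refl {t} t≢0 = cons (x^n≢0 (2 ℕ.* j ℕ.+ 1) u≢0) [] (trans (+-identityʳ _)
      (trans (cong (_* ⟦ x ⟧) (cube-root u≢0)) u*x≡t))
      where
      x⁻¹ = proj₁ (inverse x≢0)
      u*x≡t : t * x⁻¹ * ⟦ x ⟧ ≡ t
      u*x≡t = trans (*-assoc t x⁻¹ ⟦ x ⟧) (trans (cong (t *_) (proj₂ (inverse x≢0))) (*-identityʳ t))
      u≢0 : t * x⁻¹ ≢ 0#
      u≢0 = factor≢0 t≢0 u*x≡t

    local : Local p 1
    local = record
      { d>0 = s≤s z≤n
      ; d<p = subst (λ k → 2 ℕ.≤ suc k) (sym m≡3j+1) (s≤s (ℕ.m≤n+m 1 (3 ℕ.* j)))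
      ; cover = λ xs 2≤len → sum⇒zeroSum (covers⇒all-targets covers p∤2 xs 2≤len 0#)
      ; obstruction = 1 ∷ []
      ; length≡d = refl
      ; zero-free = zero-free }
      where
      zero-free : ∀ {ys} → ys ⊆ 1 ∷ [] → ZeroSum p ys → ys ≡ []
      zero-free (_ ∷ʳ [])  _ = refl
      zero-free (refl ∷ []) z = contradiction (zeroSum⇒sum p-prime z) (¬sum-[x]≡0 (1≢0 ∘ trans (sym ⟦1⟧)))

  module ThreeClasses (p-prime : Prime p) (p∤2 : ¬ (p ∣ 2)) (k : ℕ) {{k≢0 : NonZero k}} (m≡3k : m ≡ 3 ℕ.* k) (k≥6 : 6 ℕ.≤ k)
    (g : F) (g≢0 : g ≢ 0#) (g^k≢1 : g ^ k ≢ 1#) where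
    open CubeRootsOfUnity finiteField

    covers : Covers 2
    covers (x ∷ y ∷ []) (x≢0 ∷ y≢0 ∷ []) refl {t} t≢0 = represent (CubicClasses.two-units-cover finiteField k m≡3k g g≢0 g^k≢1 k≥6 x≢0 y≢0 t≢0)
      where
      represent : ∃₂ (λ a b → a ≢ 0# × b ≢ 0# × a ^ 3 * ⟦ x ⟧ + b ^ 3 * ⟦ y ⟧ ≡ t) → WeightedSum (x ∷ y ∷ []) t
      represent (a , b , a≢0 , b≢0 , e) = cons a≢0 (cons b≢0 [] (+-identityʳ _)) e

    local : Local p 2
    local = record
      { d>0 = s≤s z≤n
      ; d<p = subst (λ k → 3 ℕ.≤ suc k) (sym m≡3k) (ℕ.m≤n⇒m≤1+n (ℕ.m≤m*n 3 k))
      ; cover = λ xs 3≤len → sum⇒zeroSum (covers⇒all-targets covers p∤2 xs 3≤len 0#)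
      ; obstruction = 1 ∷ toℕ g ∷ []
      ; length≡d = refl
      ; zero-free = zero-free }
      where
      ¬sum-1-g : ¬ WeightedSum (1 ∷ toℕ g ∷ []) 0#
      ¬sum-1-g (cons {a} a≢0 (cons {b} b≢0 [] refl) e) = noncube (a³+b³x≡0⇒x-cube a≢0 b≢0 (trans (sym (cong₂ _+_
        (trans (cong (a ^ 3 *_) ⟦1⟧) (*-identityʳ (a ^ 3))) (trans (+-identityʳ _) (cong (b ^ 3 *_) (⟦toℕ⟧ g))))) e))
        where
        noncube : ¬ (∃ λ c → c ≢ 0# × c ^ 3 ≡ g)
        noncube (c , c≢0 , c³≡g) = CubicClasses.g-noncube finiteField k m≡3k g g≢0 g^k≢1 c≢0 c³≡g
      zero-free : ∀ {ys} → ys ⊆ 1 ∷ toℕ g ∷ [] → ZeroSum p ys → ys ≡ []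
      zero-free (_ ∷ʳ (_ ∷ʳ []))    _ = refl
      zero-free (refl ∷ (_ ∷ʳ []))  z = contradiction (zeroSum⇒sum p-prime z) (¬sum-[x]≡0 (1≢0 ∘ trans (sym ⟦1⟧)))
      zero-free (_ ∷ʳ (refl ∷ []))  z = contradiction (zeroSum⇒sum p-prime z) (¬sum-[x]≡0 (g≢0 ∘ trans (sym (⟦toℕ⟧ g))))
      zero-free (refl ∷ (refl ∷ [])) z = contradiction (zeroSum⇒sum p-prime z) ¬sum-1-g

  local-three-classes : Prime p → ¬ (p ∣ 2) → ∀ k′ → m ≡ 3 ℕ.* suc k′ → 6 ℕ.≤ suc k′ → Local p 2
  local-three-classes p-prime p∤2 k′ m≡3k k≥6 = choose (NonCube.g-exists finiteField k′ m≡3k)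
    where
    choose : ∃ (λ g → g ≢ 0# × g ^ suc k′ ≢ 1#) → Local p 2
    choose (g , g≢0 , g^k≢1) = ThreeClasses.local p-prime p∤2 (suc k′) m≡3k k≥6 g g≢0 g^k≢1

-- Selecting subsequences

module _ {A : Set} where
  ⊆-++⁻ : ∀ xs {ys zs : List A} → zs ⊆ xs ++ ys → ∃₂ λ as bs → zs ≡ as ++ bs × as ⊆ xs × bs ⊆ ys
  ⊆-++⁻ []       τ = [] , _ , refl , [] , τ
  ⊆-++⁻ (x ∷ xs) (.x ∷ʳ τ) with ⊆-++⁻ xs τ
  ... | as , bs , eq , σ , ρ = as , bs , eq , x ∷ʳ σ , ρ
  ⊆-++⁻ (x ∷ xs) (refl ∷ τ) with ⊆-++⁻ xs τ
  ... | as , bs , eq , σ , ρ = x ∷ as , bs , cong (x ∷_) eq , refl ∷ σ , ρ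

  ⊆-map⁻ : ∀ {B : Set} (f : A → B) {xs ys} → ys ⊆ map f xs → ∃ λ zs → ys ≡ map f zs × zs ⊆ xs
  ⊆-map⁻ f {[]}     []         = [] , refl , []
  ⊆-map⁻ f {x ∷ xs} (_ ∷ʳ τ) with ⊆-map⁻ f τ
  ... | zs , eq , σ = zs , eq , x ∷ʳ σ
  ⊆-map⁻ f {x ∷ xs} (refl ∷ τ) with ⊆-map⁻ f τ
  ... | zs , eq , σ = x ∷ zs , cong (f x ∷_) eq , refl ∷ σ

  -- The union is taken by position, so a term chosen twice is kept once. It collects the units
  -- reserved for different primes.
  ⊆-union : ∀ {as bs xs : List A} → as ⊆ xs → bs ⊆ xs →
    ∃ λ cs → cs ⊆ xs × as ⊆ cs × bs ⊆ cs × length cs ℕ.≤ length as ℕ.+ length bs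
  ⊆-union [] [] = [] , [] , [] , [] , z≤n
  ⊆-union (x ∷ʳ σ) (_ ∷ʳ τ) with ⊆-union σ τ
  ... | cs , ρ , σ′ , τ′ , len = cs , x ∷ʳ ρ , σ′ , τ′ , len
  ⊆-union (_∷_ {x = x} refl σ) (_ ∷ʳ τ) with ⊆-union σ τ
  ... | cs , ρ , σ′ , τ′ , len = x ∷ cs , refl ∷ ρ , refl ∷ σ′ , x ∷ʳ τ′ , s≤s len
  ⊆-union {as} {_ ∷ bs} (x ∷ʳ σ) (refl ∷ τ) with ⊆-union σ τ
  ... | cs , ρ , σ′ , τ′ , len = x ∷ cs , refl ∷ ρ , x ∷ʳ σ′ , refl ∷ τ′ ,
    ℕ.≤-trans (s≤s len) (ℕ.≤-reflexive (sym (ℕ.+-suc (length as) (length bs))))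
  ⊆-union {_ ∷ as} {_ ∷ bs} (_∷_ {x = x} refl σ) (refl ∷ τ) with ⊆-union σ τ
  ... | cs , ρ , σ′ , τ′ , len = x ∷ cs , refl ∷ ρ , refl ∷ σ′ , refl ∷ τ′ ,
    s≤s (ℕ.≤-trans len (ℕ.+-monoʳ-≤ (length as) (ℕ.n≤1+n (length bs))))

  ⊆-extend : ∀ {zs xs : List A} N → zs ⊆ xs → length zs ℕ.≤ N → N ℕ.≤ length xs →
    ∃ λ ys → zs ⊆ ys × ys ⊆ xs × length ys ≡ N
  ⊆-extend zero    [] _ _ = [] , [] , [] , refl
  ⊆-extend N (_∷ʳ_ {ys = xs} x σ) len≤N N≤len with ℕ.m≤n⇒m<n∨m≡n N≤len
  ... | inj₂ refl = x ∷ xs , x ∷ʳ σ , ⊆-refl , refl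
  ... | inj₁ N<len with ⊆-extend N σ len≤N (ℕ.s≤s⁻¹ N<len)
  ...   | ys , ρ , τ , len = ys , ρ , x ∷ʳ τ , len
  ⊆-extend (suc N) (_∷_ {x = x} refl σ) (s≤s len≤N) (s≤s N≤len) with ⊆-extend N σ len≤N N≤len
  ... | ys , ρ , τ , len = x ∷ ys , refl ∷ ρ , refl ∷ τ , cong suc len

  length-filter-¬ : ∀ {P : A → Set} (P? : Decidable P) xs → length xs ≡ length (filter P? xs) ℕ.+ length (filter (¬? ∘ P?) xs)
  length-filter-¬ P? [] = refl
  length-filter-¬ P? (x ∷ xs) with P? x
  ... | yes _ = cong suc (length-filter-¬ P? xs)
  ... | no  _ = trans (cong suc (length-filter-¬ P? xs)) (sym (ℕ.+-suc (length (filter P? xs)) _))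

-- In the application the indices are primes and `P i x` says that the prime does not divide `x`;
-- one term may serve several primes.
module Selection {I A : Set} {P : I → A → Set} (P? : ∀ i → Decidable (P i)) (d : I → ℕ) where

  count : I → List A → ℕ
  count i xs = length (filter (P? i) xs)

  Balanced : List A → I → Set
  Balanced xs i = count i xs ≡ 0 ⊎ suc (d i) ℕ.≤ count i xs

  count-mono : ∀ i {xs ys} → xs ⊆ ys → count i xs ℕ.≤ count i ys
  count-mono i τ = Sublist.length-mono-≤ (Sublist.filter⁺ (P? i) (P? i) (λ { refl p → p }) τ)

  count≡0-⊆ : ∀ i {xs ys} → xs ⊆ ys → count i ys ≡ 0 → count i xs ≡ 0
  count≡0-⊆ i τ eq = ℕ.n≤0⇒n≡0 (ℕ.≤-trans (count-mono i τ) (ℕ.≤-reflexive eq))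

  -- While some index has between 1 and d i elements satisfying P i, discard these elements and
  -- stop caring about i.
  balance : ∀ N s L xs → length L ≡ s → N ℕ.+ sum (map d L) ℕ.≤ length xs → ∃ λ ys → ys ⊆ xs × N ℕ.≤ length ys × All (Balanced ys) L
  balance N s L xs lenL len with All.all? (λ i → (count i xs ℕ.≟ 0) ⊎-dec (suc (d i) ℕ.≤? count i xs)) L
  ... | yes balanced = xs , ⊆-refl , ℕ.≤-trans (ℕ.m≤m+n N _) len , balanced
  ... | no ¬balanced with find (All.¬All⇒Any¬ (λ i → (count i xs ℕ.≟ 0) ⊎-dec (suc (d i) ℕ.≤? count i xs)) L ¬balanced)
  ... | i , i∈L , ¬balanced-i with ∈-∃++ i∈L
  balance N zero    .(L₁ ++ [ i ] ++ L₂) xs lenL len | no _ | i , _ , _ | L₁ , L₂ , refl =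
    contradiction (trans (sym (List.length-++-sucʳ L₁ i L₂)) lenL) (λ ())
  -- The recursion runs on the length `s`, because taking `i` out of the middle of the list is not a
  -- structural descent.
  balance N (suc s) .(L₁ ++ [ i ] ++ L₂) xs lenL len | no _ | i , _ , ¬balanced-i | L₁ , L₂ , refl
    with balance N s (L₁ ++ L₂) (filter (¬? ∘ P? i) xs) (ℕ.suc-injective (trans (sym (List.length-++-sucʳ L₁ i L₂)) lenL)) remaining
    where
    swap : ∀ a b c e → a ℕ.+ (b ℕ.+ (c ℕ.+ e)) ≡ a ℕ.+ (b ℕ.+ e) ℕ.+ c
    swap = solve-∀
    sum-split : N ℕ.+ sum (map d (L₁ ++ [ i ] ++ L₂)) ≡ N ℕ.+ sum (map d (L₁ ++ L₂)) ℕ.+ d i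
    sum-split = trans (cong (N ℕ.+_) (trans (cong sum (List.map-++ d L₁ (i ∷ L₂))) (sum-++ (map d L₁) (map d (i ∷ L₂)))))
      (trans (swap N (sum (map d L₁)) (d i) (sum (map d L₂)))
        (cong (λ z → N ℕ.+ z ℕ.+ d i) (sym (trans (cong sum (List.map-++ d L₁ L₂)) (sum-++ (map d L₁) (map d L₂))))))
    count≤d : count i xs ℕ.≤ d i
    count≤d = ℕ.s≤s⁻¹ (ℕ.≰⇒> (¬balanced-i ∘ inj₂))
    remaining : N ℕ.+ sum (map d (L₁ ++ L₂)) ℕ.≤ length (filter (¬? ∘ P? i) xs)
    remaining = ℕ.+-cancelʳ-≤ (d i) _ _ (ℕ.≤-trans (ℕ.≤-reflexive (sym sum-split)) (ℕ.≤-trans len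
      (ℕ.≤-trans (ℕ.≤-reflexive (trans (length-filter-¬ (P? i) xs) (ℕ.+-comm (count i xs) _))) (ℕ.+-monoʳ-≤ _ count≤d))))
  ... | ys , ys⊆ , N≤ , balanced = ys , ⊆-trans ys⊆ (Sublist.filter-⊆ (¬? ∘ P? i) xs) , N≤ ,
    All.++⁺ (All.++⁻ˡ L₁ balanced) (inj₁ count-i ∷ All.++⁻ʳ L₁ balanced)
    where
    -- The discarded index stays balanced: no element satisfying `P i` survives the filter, hence
    -- none occurs in any later subsequence.
    count-i : count i ys ≡ 0
    count-i = count≡0-⊆ i ys⊆ (cong length (List.filter-none (P? i) (All.all-filter (¬? ∘ P? i) xs)))

  -- The conclusion mixes `xs` and `zs` on purpose: absence passes down from `xs` and abundance
  -- passes up from `zs`, so every sequence between the two is balanced.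
  core : ∀ L xs → All (Balanced xs) L → ∃ λ zs → zs ⊆ xs × length zs ℕ.≤ sum (map (suc ∘ d) L) ×
    All (λ i → count i xs ≡ 0 ⊎ suc (d i) ℕ.≤ count i zs) L
  core [] xs [] = [] , minimum xs , z≤n , []
  core (i ∷ L) xs (b ∷ bs) with core L xs bs
  core (i ∷ L) xs (inj₁ none ∷ bs) | zs , zs⊆xs , len , all = zs , zs⊆xs , ℕ.≤-trans len (ℕ.m≤n+m _ (suc (d i))) , inj₁ none ∷ all
  core (i ∷ L) xs (inj₂ many ∷ bs) | zs , zs⊆xs , len , all with ⊆-union (⊆-trans (Sublist.take-⊆ (suc (d i)) (filter (P? i) xs)) (Sublist.filter-⊆ (P? i) xs)) zs⊆xs
  ... | cs , cs⊆xs , w⊆cs , zs⊆cs , lencs = cs , cs⊆xs , ℕ.≤-trans lencs (ℕ.+-mono-≤ (ℕ.≤-reflexive len-w) len) ,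
    inj₂ (ℕ.≤-trans (ℕ.≤-reflexive (sym count-w)) (count-mono i w⊆cs)) ∷ All.map (λ {j} → Sum.map₂ (λ many′ → ℕ.≤-trans many′ (count-mono j zs⊆cs))) all
    where
    w = take (suc (d i)) (filter (P? i) xs)
    len-w : length w ≡ suc (d i)
    len-w = trans (List.length-take (suc (d i)) (filter (P? i) xs)) (ℕ.m≤n⇒m⊓n≡m many)
    count-w : count i w ≡ suc (d i)
    count-w = trans (cong length (List.filter-all (P? i) (All.take⁺ (suc (d i)) (All.all-filter (P? i) xs)))) len-w

  select : ∀ N L xs → sum (map (suc ∘ d) L) ℕ.≤ N → N ℕ.+ sum (map d L) ℕ.≤ length xs →
    ∃ λ ys → ys ⊆ xs × length ys ≡ N × All (Balanced ys) L
  select N L xs small long with balance N (length L) L xs refl long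
  ... | xs′ , xs′⊆xs , N≤ , balanced with core L xs′ balanced
  ... | zs , zs⊆xs′ , len , all with ⊆-extend N zs⊆xs′ (ℕ.≤-trans len small) N≤
  ... | ys , zs⊆ys , ys⊆xs′ , lenys = ys , ⊆-trans ys⊆xs′ xs′⊆xs , lenys ,
    All.map (λ {i} → Sum.map (count≡0-⊆ i ys⊆xs′) (λ many → ℕ.≤-trans many (count-mono i zs⊆ys))) all

-- Chinese remaindering

module _ {n : ℕ} {{_ : NonZero n}} where
  %-cong-+ : ∀ {a b c d} → a % n ≡ b % n → c % n ≡ d % n → (a ℕ.+ c) % n ≡ (b ℕ.+ d) % n
  %-cong-+ {a} {b} {c} {d} p q = trans (%-distribˡ-+ a c n) (trans (cong₂ (λ x y → (x ℕ.+ y) % n) p q) (sym (%-distribˡ-+ b d n)))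

  %-cong-* : ∀ {a b c d} → a % n ≡ b % n → c % n ≡ d % n → (a ℕ.* c) % n ≡ (b ℕ.* d) % n
  %-cong-* {a} {b} {c} {d} p q = trans (%-distribˡ-* a c n) (trans (cong₂ (λ x y → (x ℕ.* y) % n) p q) (sym (%-distribˡ-* b d n)))

  %-cong-^ : ∀ k {a b} → a % n ≡ b % n → (a ℕ.^ k) % n ≡ (b ℕ.^ k) % n
  %-cong-^ zero    p = refl
  %-cong-^ (suc k) {a} {b} p = %-cong-* {a} {b} p (%-cong-^ k {a} {b} p)

  cube-term-cong : ∀ {u v x s t} → u % n ≡ v % n → s % n ≡ t % n → (u ℕ.^ 3 ℕ.* x ℕ.+ s) % n ≡ (v ℕ.^ 3 ℕ.* x ℕ.+ t) % n
  cube-term-cong {u} {v} {x} p q = %-cong-+ {u ℕ.^ 3 ℕ.* x} (%-cong-* {u ℕ.^ 3} {v ℕ.^ 3} {x} (%-cong-^ 3 {u} {v} p) refl) q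

  ∣-cong : ∀ {d a b} → d ∣ n → a % n ≡ b % n → d ∣ a → d ∣ b
  ∣-cong d∣n e d∣a = ∣n∣m%n⇒∣m d∣n (subst (_ ∣_) e (%-presˡ-∣ d∣a d∣n))

  coprime-cong : ∀ {u v} → u % n ≡ v % n → Coprime u n → Coprime v n
  coprime-cong e c (d∣v , d∣n) = c (∣-cong d∣n (sym e) d∣v , d∣n)

module ChineseRemainder {a b : ℕ} {{a≢0 : NonZero a}} {{b≢0 : NonZero b}} where
  idempotent : Coprime a b → ∃ λ e → a ∣ e × e % b ≡ 1 % b
  idempotent c with Coprime.coprime-Bézout c
  ... | Bézout.+- x y eq = x ℕ.* a , n∣m*n x , trans (cong (_% b) (sym eq)) ([m+kn]%n≡m%n 1 y b)
  -- Here 1 + x a = y b, so x a ≡ - 1 modulo b, and its square is the required element.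
  ... | Bézout.-+ x y eq = x ℕ.* a ℕ.* (x ℕ.* a) , ∣n⇒∣m*n (x ℕ.* a) (n∣m*n x) , (begin
    (xa ℕ.* xa) % b                      ≡⟨ [m+kn]%n≡m%n (xa ℕ.* xa) y b ⟨
    (xa ℕ.* xa ℕ.+ y ℕ.* b) % b          ≡⟨ cong (λ z → (xa ℕ.* xa ℕ.+ z) % b) eq ⟨
    (xa ℕ.* xa ℕ.+ (1 ℕ.+ xa)) % b       ≡⟨ cong (_% b) (lemma xa) ⟩
    (1 ℕ.+ xa ℕ.* (1 ℕ.+ xa)) % b        ≡⟨ cong (λ z → (1 ℕ.+ xa ℕ.* z) % b) eq ⟩
    (1 ℕ.+ xa ℕ.* (y ℕ.* b)) % b         ≡⟨ cong (λ z → (1 ℕ.+ z) % b) (ℕ.*-assoc xa y b) ⟨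
    (1 ℕ.+ xa ℕ.* y ℕ.* b) % b           ≡⟨ [m+kn]%n≡m%n 1 (xa ℕ.* y) b ⟩
    1 % b                                ∎)
    where
    open ≡-Reasoning
    xa = x ℕ.* a
    lemma : ∀ z → z ℕ.* z ℕ.+ (1 ℕ.+ z) ≡ 1 ℕ.+ z ℕ.* (1 ℕ.+ z)
    lemma = solve-∀

coprime-* : ∀ {u a b} → Coprime u a → Coprime u b → Coprime u (a ℕ.* b)
coprime-* {u} {a} {b} c c′ {d} (d∣u , d∣ab) = c′ (d∣u , Coprime.coprime-divisor (λ (e∣d , e∣a) → c (∣-trans e∣d d∣u , e∣a)) d∣ab)

coprime-∣-* : ∀ {a b r} → Coprime a b → a ∣ r → b ∣ r → a ℕ.* b ∣ r
coprime-∣-* {a} {b} c (divides k refl) b∣ka =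
  subst (a ℕ.* b ∣_) (ℕ.*-comm a k) (*-monoʳ-∣ a (Coprime.coprime-divisor (Coprime.sym c) (subst (b ∣_) (ℕ.*-comm k a) b∣ka)))

module _ {a b : ℕ} {{a≢0 : NonZero a}} {{b≢0 : NonZero b}} (a⊥b : Coprime a b) where
  private
    e₂ = ChineseRemainder.idempotent {a} {b} a⊥b
    e₁ = ChineseRemainder.idempotent {b} {a} (Coprime.sym a⊥b)

  crt : ∀ u v → ∃ λ w → w % a ≡ u % a × w % b ≡ v % b
  crt u v with e₁ | e₂
  ... | f , b∣f , f≡1 | e , a∣e , e≡1 = u ℕ.* f ℕ.+ v ℕ.* e , mod-a , mod-b
    where
    1·0 : ∀ {n} {{_ : NonZero n}} x y {f e} → f % n ≡ 1 % n → n ∣ e → (x ℕ.* f ℕ.+ y ℕ.* e) % n ≡ x % n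
    1·0 {n} x y {f} {e} f≡1 n∣e = trans (%-cong-+ {n} {x ℕ.* f} {x} {y ℕ.* e} {0}
      (trans (%-cong-* {n} {x} {x} refl f≡1) (cong (_% n) (ℕ.*-identityʳ x))) (trans (n∣m⇒m%n≡0 (y ℕ.* e) n (∣n⇒∣m*n y n∣e)) (sym (n∣m⇒m%n≡0 0 n (n ∣0)))))
      (cong (_% n) (ℕ.+-identityʳ x))
    mod-a : (u ℕ.* f ℕ.+ v ℕ.* e) % a ≡ u % a
    mod-a = 1·0 u v f≡1 a∣e
    mod-b : (u ℕ.* f ℕ.+ v ℕ.* e) % b ≡ v % b
    mod-b = trans (cong (_% b) (ℕ.+-comm (u ℕ.* f) (v ℕ.* e))) (1·0 v u e≡1 b∣f)

  -- Both sums run over the same terms, so the two weights of each term can be merged into one.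
  cubeSum-crt : ∀ {xs s t} → CubeSum a xs s → CubeSum b xs t → ∃ λ r → CubeSum (a ℕ.* b) xs r × r % a ≡ s % a × r % b ≡ t % b
  cubeSum-crt [] [] = 0 , [] , refl , refl
  cubeSum-crt (cons {x} u cu σ) (cons v cv τ) with cubeSum-crt σ τ | crt u v
  ... | r , ρ , r≡s , r≡t | w , w≡u , w≡v = _ , cons w (coprime-* (coprime-cong (sym w≡u) cu) (coprime-cong (sym w≡v) cv)) ρ ,
    cube-term-cong {u = w} {u} {x} w≡u r≡s , cube-term-cong {u = w} {v} {x} w≡v r≡t

  zeroSum-crt : ∀ {xs} → ZeroSum a xs → ZeroSum b xs → ZeroSum (a ℕ.* b) xs
  zeroSum-crt (s , σ , a∣s) (t , τ , b∣t) with cubeSum-crt σ τ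
  ... | r , ρ , r≡s , r≡t = r , ρ , coprime-∣-* a⊥b (∣-cong ∣-refl (sym r≡s) a∣s) (∣-cong ∣-refl (sym r≡t) b∣t)

multiples⇒zeroSum : ∀ {n} xs → All (n ∣_) xs → ZeroSum n xs
multiples⇒zeroSum [] [] = 0 , [] , _ ∣0
multiples⇒zeroSum (x ∷ xs) (n∣x ∷ n∣xs) with multiples⇒zeroSum xs n∣xs
... | s , σ , n∣s = _ , cons 1 (Coprime.1-coprimeTo _) σ , ∣m∣n⇒∣m+n (∣n⇒∣m*n 1 n∣x) n∣s

prime⇒coprime-∤ : ∀ {p m} → Prime p → ¬ (p ∣ m) → Coprime p m
prime⇒coprime-∤ p-prime p∤m (d∣p , d∣m) = [ (λ d≡1 → d≡1) , (λ { refl → contradiction d∣m p∤m }) ]′ (prime⇒irreducible p-prime d∣p)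

zeroSum-product : ∀ {xs} ps → All Prime ps → Unique ps → All (λ p → ZeroSum p xs) ps → ZeroSum (product ps) xs
zeroSum-product {xs} [] [] [] [] = multiples⇒zeroSum xs (All.universal 1∣_ xs)
zeroSum-product (p ∷ ps) (p-prime ∷ ps-prime) (p∉ps ∷ uniq) (z ∷ zs) =
  zeroSum-crt {{prime⇒nonZero p-prime}} {{productOfPrimes≢0 ps-prime}}
    (prime⇒coprime-∤ p-prime (λ p∣Π → All.lookup p∉ps (factorisationHasAllPrimeFactors p-prime p∣Π ps-prime) refl))
    z (zeroSum-product ps ps-prime uniq zs)

-- Sequences modulo a product of distinct primes

record LocalPrime : Set where
  field
    p d     : ℕ
    p-prime : Prime p
    local   : Local p d
  open Local local public

open LocalPrime using (p; d; p-prime; local)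

-- This guarantees that the reserved units fit into n terms. Each d + 1 is at most p, and m + n ≤ m
-- n for m, n ≥ 2; a single prime is treated apart because the empty product is only 1.
sum≤product : ∀ L → sum (map (suc ∘ d) L) ℕ.≤ product (map p L)
sum≤product [] = z≤n
sum≤product (l ∷ []) = ℕ.≤-trans (ℕ.≤-reflexive (ℕ.+-identityʳ _)) (ℕ.≤-trans (LocalPrime.d<p l) (ℕ.≤-reflexive (sym (ℕ.*-identityʳ (p l)))))
sum≤product (l ∷ L@(l′ ∷ _)) = ℕ.≤-trans (ℕ.+-mono-≤ (LocalPrime.d<p l) (sum≤product L))
  (m+n≤m*n (ℕ.≤-trans (s≤s (LocalPrime.d>0 l)) (LocalPrime.d<p l))
    (ℕ.≤-trans (ℕ.≤-trans (s≤s (LocalPrime.d>0 l′)) (ℕ.m≤m+n (suc (d l′)) _)) (sum≤product L)))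
  where
  m+n≤m*n : ∀ {m n} → 2 ℕ.≤ m → 2 ℕ.≤ n → m ℕ.+ n ℕ.≤ m ℕ.* n
  m+n≤m*n {suc (suc m)} {suc (suc n)} (s≤s (s≤s z≤n)) (s≤s (s≤s z≤n)) = ℕ.≤-trans (ℕ.m≤m+n _ (m ℕ.+ n ℕ.+ m ℕ.* n)) (ℕ.≤-reflexive (lemma m n))
    where
    lemma : ∀ m n → suc (suc m) ℕ.+ suc (suc n) ℕ.+ (m ℕ.+ n ℕ.+ m ℕ.* n) ≡ suc (suc m) ℕ.* suc (suc n)
    lemma = solve-∀

-- At each prime the selected terms either include enough units for `cover` or are all multiples of
-- it; the local zero sums are then glued.
zeroSum-subsequence : ∀ L → Unique (map p L) → ∀ xs → product (map p L) ℕ.+ sum (map d L) ℕ.≤ length xs →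
  ∃ λ ys → ys ⊆ xs × length ys ≡ product (map p L) × ZeroSum (product (map p L)) ys
zeroSum-subsequence L uniq xs long with Selection.select (λ l x → ¬? (p l ∣? x)) d (product (map p L)) L xs (sum≤product L) long
... | ys , ys⊆xs , len , balanced = ys , ys⊆xs , len ,
  zeroSum-product (map p L) (All.map⁺ (All.universal p-prime L)) uniq (All.map⁺ (All.map (λ {l} → locally l) balanced))
  where
  locally : ∀ l → Selection.Balanced (λ l x → ¬? (p l ∣? x)) d ys l → ZeroSum (p l) ys
  locally l (inj₂ many) = LocalPrime.cover l ys many
  locally l (inj₁ none) = multiples⇒zeroSum ys (all-multiples ys none)
    where
    all-multiples : ∀ zs → length (nonMultiples (p l) zs) ≡ 0 → All (p l ∣_) zs
    all-multiples [] _ = []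
    all-multiples (z ∷ zs) none = go (p l ∣? z)
      where
      go : Dec (p l ∣ z) → All (p l ∣_) (z ∷ zs)
      go (yes p∣z) = p∣z ∷ all-multiples zs (trans (sym (cong length (nonMultiples-∣ zs p∣z))) none)
      go (no p∤z) with trans (sym (cong length (nonMultiples-∤ zs p∤z))) none
      ... | ()

-- Weights coprime to a b are coprime to both factors. The second block carries a common factor `a`,
-- so that its remaining sum can be read modulo `b`.
cubeSum-split : ∀ a b xs {ys s} → CubeSum (a ℕ.* b) (xs ++ map (a ℕ.*_) ys) s →
  ∃₂ λ s₁ s₂ → CubeSum a xs s₁ × CubeSum b ys s₂ × s ≡ s₁ ℕ.+ a ℕ.* s₂
cubeSum-split a b [] {[]} [] = 0 , 0 , [] , [] , sym (ℕ.*-zeroʳ a)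
cubeSum-split a b [] {y ∷ ys} (cons u c σ) with cubeSum-split a b [] σ
... | _ , s₂ , [] , σ₂ , refl = 0 , _ , [] , cons u (λ (d∣u , d∣b) → c (d∣u , ∣n⇒∣m*n a d∣b)) σ₂ , lemma (u ℕ.^ 3) a y s₂
  where
  lemma : ∀ w a y s → w ℕ.* (a ℕ.* y) ℕ.+ a ℕ.* s ≡ a ℕ.* (w ℕ.* y ℕ.+ s)
  lemma = solve-∀
cubeSum-split a b (x ∷ xs) (cons u c σ) with cubeSum-split a b xs σ
... | s₁ , s₂ , σ₁ , σ₂ , refl = _ , s₂ , cons u (λ (d∣u , d∣a) → c (d∣u , ∣m⇒∣m*n b d∣a)) σ₁ , σ₂ , sym (ℕ.+-assoc (u ℕ.^ 3 ℕ.* x) s₁ (a ℕ.* s₂))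

-- Modulo the first prime only its own block is visible; once that block is known to be unused,
-- the factor p can be cancelled from the rest.
zeroFreeSequence : ∀ L → ∃ λ ws → length ws ≡ sum (map d L) × (∀ {ys} → ys ⊆ ws → ZeroSum (product (map p L)) ys → ys ≡ [])
zeroFreeSequence [] = [] , refl , λ { [] _ → refl }
zeroFreeSequence (l ∷ L) with zeroFreeSequence L
... | ws , len , zero-free = obstruction l ++ map (p l ℕ.*_) ws ,
  trans (List.length-++ (obstruction l)) (cong₂ ℕ._+_ (length≡d l) (trans (List.length-map (p l ℕ.*_) ws) len)) ,
  zero-free′
  where
  open LocalPrime using (obstruction; length≡d)
  instance
    p≢0 : NonZero (p l)
    p≢0 = prime⇒nonZero (p-prime l)
  zero-free′ : ∀ {ys} → ys ⊆ obstruction l ++ map (p l ℕ.*_) ws → ZeroSum (p l ℕ.* product (map p L)) ys → ys ≡ []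
  zero-free′ ys⊆ (s , σ , ∣s) with ⊆-++⁻ (obstruction l) ys⊆
  ... | as , bs , refl , as⊆ , bs⊆ with ⊆-map⁻ (p l ℕ.*_) bs⊆
  ... | cs , refl , cs⊆ with cubeSum-split (p l) (product (map p L)) as σ
  ... | s₁ , s₂ , σ₁ , σ₂ , refl with LocalPrime.zero-free l as⊆
          (s₁ , σ₁ , ∣m+n∣m⇒∣n (subst (p l ∣_) (ℕ.+-comm s₁ (p l ℕ.* s₂)) (∣-trans (m∣m*n (product (map p L))) ∣s)) (m∣m*n s₂))
  ... | refl with σ₁
  ... | [] = cong (map (p l ℕ.*_)) (zero-free cs⊆ (s₂ , σ₂ , *-cancelˡ-∣ (p l) ∣s))

-- The two constants

module ResidueSequences (n′ : ℕ) where
  private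
    n = suc n′

    toℕ-mod : ∀ a → toℕ (a mod n) ≡ a % n
    toℕ-mod a = Fin.toℕ-fromℕ< (m%n<n a n)

    toℕ-mod-% : ∀ a → toℕ (a mod n) % n ≡ a % n
    toℕ-mod-% a = trans (cong (_% n) (toℕ-mod a)) (m%n%n≡m%n a n)

  cubeSum⇒wSum : ∀ xs {s} → CubeSum n (map toℕ xs) s → ∃ λ t → WSum n (CubeUnit n) xs t × t % n ≡ s % n
  cubeSum⇒wSum [] [] = 0 , [] , refl
  cubeSum⇒wSum (x ∷ xs) (cons {s = s} u c σ) with cubeSum⇒wSum xs σ
  ... | t , τ , t≡s = toℕ w ℕ.* toℕ x ℕ.+ t ,
    (a , coprime-cong (sym (toℕ-mod-% u)) c , toℕ a ℕ.^ 3 / n ,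
      trans (m≡m%n+[m/n]*n (toℕ a ℕ.^ 3) n) (cong (ℕ._+ toℕ a ℕ.^ 3 / n ℕ.* n) (sym (toℕ-mod (toℕ a ℕ.^ 3))))) ∷ τ ,
    %-cong-+ {a = toℕ w ℕ.* toℕ x} {u ℕ.^ 3 ℕ.* toℕ x} {t} {s}
      (%-cong-* {a = toℕ w} {u ℕ.^ 3} {toℕ x} (trans (toℕ-mod-% (toℕ a ℕ.^ 3)) (%-cong-^ 3 {toℕ a} {u} (toℕ-mod-% u))) refl) t≡s
    where
    a w : Fin n
    a = u mod n
    w = (toℕ a ℕ.^ 3) mod n

  wSum⇒cubeSum : ∀ ys {s} → WSum n (CubeUnit n) (map (_mod n) ys) s → ∃ λ t → CubeSum n ys t × t % n ≡ s % n
  wSum⇒cubeSum [] [] = 0 , [] , refl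
  wSum⇒cubeSum (y ∷ ys) (_∷_ {w} {s = s} (a , unit , k , a³≡w) σ) with wSum⇒cubeSum ys σ
  ... | t , τ , t≡s = toℕ a ℕ.^ 3 ℕ.* y ℕ.+ t , cons (toℕ a) unit τ ,
    %-cong-+ {a = toℕ a ℕ.^ 3 ℕ.* y} {toℕ w ℕ.* toℕ (y mod n)} {t} {s}
      (%-cong-* {a = toℕ a ℕ.^ 3} {toℕ w} {y} {toℕ (y mod n)} (trans (cong (_% n) a³≡w) ([m+kn]%n≡m%n (toℕ w) k n)) (sym (toℕ-mod-% y))) t≡s

  zeroSum⇒wZeroSum : ∀ xs → ZeroSum n (map toℕ xs) → WZeroSum n (CubeUnit n) xs
  zeroSum⇒wZeroSum xs (s , σ , n∣s) with cubeSum⇒wSum xs σ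
  ... | t , τ , t≡s = t , τ , ∣-cong ∣-refl (sym t≡s) n∣s

  wZeroSum⇒zeroSum : ∀ ys → WZeroSum n (CubeUnit n) (map (_mod n) ys) → ZeroSum n ys
  wZeroSum⇒zeroSum ys (s , σ , n∣s) with wSum⇒cubeSum ys σ
  ... | t , τ , t≡s = t , τ , ∣-cong ∣-refl (sym t≡s) n∣s

module _ {n′ : ℕ} {A : Fin (suc n′) → Set} where
  private
    n = suc n′

    wSum-zeros : ∀ k {ys s} → ys ⊆ replicate k zero → WSum n A ys s → s ≡ 0
    wSum-zeros zero    []         []                = refl
    wSum-zeros (suc k) (_ ∷ʳ τ)   σ                 = wSum-zeros k τ σ
    wSum-zeros (suc k) (refl ∷ τ) (_∷_ {a} w σ) = cong₂ ℕ._+_ (ℕ.*-zeroʳ (toℕ a)) (wSum-zeros k τ σ)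

    wSum-++⁻ : ∀ xs {ys s} → WSum n A (xs ++ ys) s → ∃₂ λ s₁ s₂ → WSum n A xs s₁ × WSum n A ys s₂ × s ≡ s₁ ℕ.+ s₂
    wSum-++⁻ []       σ = 0 , _ , [] , σ , refl
    wSum-++⁻ (x ∷ xs) (_∷_ {a} w σ) with wSum-++⁻ xs σ
    ... | s₁ , s₂ , σ₁ , σ₂ , refl = _ , s₂ , w ∷ σ₁ , σ₂ , sym (ℕ.+-assoc (toℕ a ℕ.* toℕ x) s₁ s₂)

  -- Zeros contribute nothing under any weight, and at most `k` of them are lost. Both the lower
  -- bounds and the passage from E to D rest on this.
  drop-zeros : ∀ k xs {ys} → ys ⊆ xs ++ replicate k zero → WZeroSum n A ys →
    ∃ λ zs → zs ⊆ xs × length ys ℕ.≤ length zs ℕ.+ k × WZeroSum n A zs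
  drop-zeros k xs ys⊆ (s , σ , n∣s) with ⊆-++⁻ xs ys⊆
  ... | zs , os , refl , zs⊆ , os⊆ with wSum-++⁻ zs σ
  ... | s₁ , s₂ , σ₁ , σ₂ , refl = zs , zs⊆ ,
    ℕ.≤-trans (ℕ.≤-reflexive (List.length-++ zs)) (ℕ.+-monoʳ-≤ (length zs) (ℕ.≤-trans (Sublist.length-mono-≤ os⊆) (ℕ.≤-reflexive (List.length-replicate k)))) ,
    (s₁ , σ₁ , subst (n ∣_) (trans (cong (s₁ ℕ.+_) (wSum-zeros k os⊆ σ₂)) (ℕ.+-identityʳ s₁)) n∣s)

module Constants (n′ D : ℕ)
  (subsequence : ∀ xs → suc n′ ℕ.+ D ℕ.≤ length xs → ∃ λ ys → ys ⊆ xs × length ys ≡ suc n′ × ZeroSum (suc n′) ys)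
  (ws : List ℕ) (length-ws : length ws ≡ D) (zero-free : ∀ {ys} → ys ⊆ ws → ZeroSum (suc n′) ys → ys ≡ []) where
  open ResidueSequences n′
  private
    n = suc n′
    T = CubeUnit n

    -- The extremal sequences: k = n - 1 serves for E and k = 0 for D.
    V : ℕ → List (Fin n)
    V k = map (_mod n) ws ++ replicate k zero

    length-V : ∀ k → length (V k) ≡ D ℕ.+ k
    length-V k = trans (List.length-++ (map (_mod n) ws)) (cong₂ ℕ._+_ (trans (List.length-map (_mod n) ws) length-ws) (List.length-replicate k))

    -- Once its appended zeros are dropped, a zero-sum subsequence comes from `ws` and is empty; it
    -- consisted of appended zeros alone.
    zero-sums-in-V : ∀ k {ys} → ys ⊆ V k → WZeroSum n T ys → length ys ℕ.≤ k
    zero-sums-in-V k ys⊆V z with drop-zeros k (map (_mod n) ws) ys⊆V z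
    ... | zs , zs⊆ , len , z′ with ⊆-map⁻ (_mod n) zs⊆
    ... | us , refl , us⊆ws with zero-free us⊆ws (wZeroSum⇒zeroSum us z′)
    ... | refl = len

    prefix-of-V : ∀ k m → m ℕ.≤ D ℕ.+ k → length (take m (V k)) ≡ m
    prefix-of-V k m m≤ = trans (List.length-take m (V k)) (ℕ.m≤n⇒m⊓n≡m (ℕ.≤-trans m≤ (ℕ.≤-reflexive (sym (length-V k)))))

  eProp : EProp n T (n ℕ.+ D)
  eProp xs len with subsequence (map toℕ xs) (ℕ.≤-reflexive (sym (trans (List.length-map toℕ xs) len)))
  ... | ys , ys⊆ , lenys , z with ⊆-map⁻ toℕ ys⊆
  ... | zs , refl , zs⊆xs = zs , zs⊆xs , trans (sym (List.length-map toℕ zs)) lenys , zeroSum⇒wZeroSum zs z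

  egzw : EGZW n T (n ℕ.+ D)
  egzw = s≤s z≤n , eProp , λ m _ prop → ℕ.≮⇒≥ (λ m<n+D → minimal m prop (ℕ.≤-trans (ℕ.s≤s⁻¹ m<n+D) (ℕ.≤-reflexive (ℕ.+-comm n′ D))))
    where
    minimal : ∀ m → EProp n T m → ¬ (m ℕ.≤ D ℕ.+ n′)
    -- `V n′` has D + n - 1 terms, so every smaller candidate m is refuted by a prefix: its zero-sum
    -- subsequences have at most n - 1 terms.
    minimal m prop m≤ with prop (take m (V n′)) (prefix-of-V n′ m m≤)
    ... | ys , ys⊆ , len , z = ℕ.<-irrefl refl (subst (ℕ._≤ n′) len (zero-sums-in-V n′ (⊆-trans ys⊆ (Sublist.take-⊆ m (V n′))) z))

  davenport : DavenportW n T (D ℕ.+ 1)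
  davenport = ℕ.m≤n+m 1 D , dProp , λ m _ prop → ℕ.≮⇒≥ (λ m<D+1 → minimal m prop (ℕ.≤-trans (ℕ.s≤s⁻¹ (ℕ.≤-trans m<D+1 (ℕ.≤-reflexive (ℕ.+-comm D 1)))) (ℕ.m≤m+n D 0)))
    where
    dProp : DProp n T (D ℕ.+ 1)
    dProp xs len with eProp (xs ++ replicate n′ zero) (trans (List.length-++ xs) (trans (cong₂ ℕ._+_ len (List.length-replicate n′)) (trans (ℕ.+-assoc D 1 n′) (ℕ.+-comm D n))))
    ... | ys , ys⊆ , lenys , z with drop-zeros n′ xs ys⊆ z
    -- Of the n terms at most n - 1 are appended zeros, so at least one belongs to `xs`.
    ... | zs , zs⊆ , len≤ , z′ = zs , zs⊆ , ℕ.+-cancelʳ-≤ n′ 1 (length zs) (ℕ.≤-trans (ℕ.≤-reflexive (sym lenys)) len≤) , z′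
    minimal : ∀ m → DProp n T m → ¬ (m ℕ.≤ D ℕ.+ 0)
    minimal m prop m≤ with prop (take m (V 0)) (prefix-of-V 0 m m≤)
    ... | ys , ys⊆ , 1≤len , z = ℕ.<⇒≱ 1≤len (zero-sums-in-V 0 (⊆-trans ys⊆ (Sublist.take-⊆ m (V 0))) z)

-- Local data for the primes dividing n

odd-prime-∤2 : ∀ {p} → Prime p → ¬ (2 ∣ p) → ¬ (p ∣ 2)
odd-prime-∤2 p-prime 2∤p p∣2 = [ (λ { refl → ¬prime[1] p-prime }) , (λ { refl → 2∤p ∣-refl }) ]′ (prime⇒irreducible prime[2] p∣2)

local-2mod3 : ∀ {q} → Prime q → q % 3 ≡ 2 → ¬ (2 ∣ q) → Local q 1
local-2mod3 {zero}  q-prime _ _ = contradiction q-prime ¬prime[0]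
local-2mod3 {suc m} q-prime q≡2 2∤q = LocalSums.UnitsAreCubes.local (residueField m q-prime) q-prime (odd-prime-∤2 q-prime 2∤q) (suc m / 3) m≡
  where
  m≡ : m ≡ 3 ℕ.* (suc m / 3) ℕ.+ 1
  m≡ = ℕ.suc-injective (trans (m≡m%n+[m/n]*n (suc m) 3) (trans (cong (ℕ._+ suc m / 3 ℕ.* 3) q≡2)
    (cong suc (trans (ℕ.+-comm 1 _) (cong (ℕ._+ 1) (ℕ.*-comm (suc m / 3) 3))))))

local-1mod3 : ∀ {p} → Prime p → p % 3 ≡ 1 → ¬ (2 ∣ p) → p ≢ 7 → p ≢ 13 → Local p 2
local-1mod3 {zero}  p-prime _ _ _ _ = contradiction p-prime ¬prime[0]
local-1mod3 {suc m} p-prime p≡1 2∤p p≢7 p≢13 = go (suc m / 3) (ℕ.suc-injective (trans (m≡m%n+[m/n]*n (suc m) 3)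
    (trans (cong (ℕ._+ suc m / 3 ℕ.* 3) p≡1) (cong suc (ℕ.*-comm (suc m / 3) 3)))))
  where
  -- The values k < 6 stand for 1, 4, 7, 10, 13 and 16: not a prime, even, or excluded by
  -- hypothesis.
  go : ∀ k → m ≡ 3 ℕ.* k → Local (suc m) 2
  go 0 refl = contradiction p-prime ¬prime[1]
  go 1 refl = contradiction (divides 2 refl) 2∤p
  go 2 refl = contradiction refl p≢7
  go 3 refl = contradiction (divides 5 refl) 2∤p
  go 4 refl = contradiction refl p≢13
  go 5 refl = contradiction (divides 8 refl) 2∤p
  go (suc (suc (suc (suc (suc (suc _)))))) m≡3k =
    LocalSums.local-three-classes (residueField m p-prime) p-prime (odd-prime-∤2 p-prime 2∤p) _ m≡3k
      (s≤s (s≤s (s≤s (s≤s (s≤s (s≤s z≤n))))))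

open LocalPrime using (p; d)

localPrimes : ∀ {P : ℕ → Set} c → (∀ {p} → P p → Prime p × Local p c) → ∀ ps → All P ps →
  ∃ λ L → map p L ≡ ps × sum (map d L) ≡ c ℕ.* length ps
localPrimes c make [] [] = [] , refl , sym (ℕ.*-zeroʳ c)
localPrimes c make (q ∷ ps) (h ∷ hs) with make h | localPrimes c make ps hs
... | q-prime , loc | L , eq , eq′ = record { p = q ; d = c ; p-prime = q-prime ; local = loc } ∷ L ,
  cong (q ∷_) eq , trans (cong (c ℕ.+_) eq′) (sym (ℕ.*-suc c (length ps)))

open import Data.Nat using (ℕ; _+_; _*_; _%_)

theorem1p1 : (n : ℕ) (ps qs : List ℕ) →
    All Prime ps → All (λ p → p % 3 ≡ 1) ps →
    All Prime qs → All (λ q → q % 3 ≡ 2) qs →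
    Unique (ps ++ qs) →
    n ≡ product ps * product qs →
    n % 2 ≡ 1 → ¬ (7 ∣ n) → ¬ (13 ∣ n) →
    DavenportW n (CubeUnit n) (2 * length ps + length qs + 1)
    × EGZW n (CubeUnit n) (n + 2 * length ps + length qs)
theorem1p1 zero ps qs _ _ _ _ _ _ () _ _
theorem1p1 n@(suc n′) ps qs ps-prime ps≡1 qs-prime qs≡2 uniq n≡ n-odd 7∤n 13∤n =
  davenport , subst (EGZW n (CubeUnit n)) (sym (ℕ.+-assoc n (2 * length ps) (length qs))) egzw
  where
  2∤n : ¬ (2 ∣ n)
  2∤n 2∣n with trans (sym n-odd) (n∣m⇒m%n≡0 n 2 2∣n)
  ... | ()

  ps∣n : All (_∣ n) ps
  ps∣n = All.tabulate (λ {p} p∈ps → subst (p ∣_) (sym n≡) (∣m⇒∣m*n (product qs) (∈⇒∣product p∈ps)))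

  qs∣n : All (_∣ n) qs
  qs∣n = All.tabulate (λ {q} q∈qs → subst (q ∣_) (sym n≡) (∣n⇒∣m*n (product ps) (∈⇒∣product q∈qs)))

  L₁ = localPrimes 2 (λ { (p-prime , p≡1 , p∣n) → p-prime , local-1mod3 p-prime p≡1 (λ 2∣p → 2∤n (∣-trans 2∣p p∣n))
         (λ { refl → 7∤n p∣n }) (λ { refl → 13∤n p∣n }) }) ps (All.zip (ps-prime , All.zip (ps≡1 , ps∣n)))
  L₂ = localPrimes 1 (λ { (q-prime , q≡2 , q∣n) → q-prime , local-2mod3 q-prime q≡2 (λ 2∣q → 2∤n (∣-trans 2∣q q∣n)) })
         qs (All.zip (qs-prime , All.zip (qs≡2 , qs∣n)))

  L = proj₁ L₁ ++ proj₁ L₂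

  D = 2 * length ps + length qs

  primes-L : map p L ≡ ps ++ qs
  primes-L = trans (List.map-++ p (proj₁ L₁) (proj₁ L₂)) (cong₂ _++_ (proj₁ (proj₂ L₁)) (proj₁ (proj₂ L₂)))

  product-L : product (map p L) ≡ n
  product-L = trans (cong product primes-L) (trans (product-++ ps qs) (sym n≡))

  sum-L : sum (map d L) ≡ D
  sum-L = trans (cong sum (List.map-++ d (proj₁ L₁) (proj₁ L₂))) (trans (sum-++ (map d (proj₁ L₁)) (map d (proj₁ L₂)))
    (cong₂ _+_ (proj₂ (proj₂ L₁)) (trans (proj₂ (proj₂ L₂)) (ℕ.*-identityˡ (length qs)))))

  subsequence : ∀ xs → n + D ℕ.≤ length xs → ∃ λ ys → ys ⊆ xs × length ys ≡ n × ZeroSum n ys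
  subsequence = subst₂ (λ n D → ∀ xs → n + D ℕ.≤ length xs → ∃ λ ys → ys ⊆ xs × length ys ≡ n × ZeroSum n ys) product-L sum-L
    (zeroSum-subsequence L (subst Unique (sym primes-L) uniq))

  ws = proj₁ (zeroFreeSequence L)

  length-ws : length ws ≡ D
  length-ws = trans (proj₁ (proj₂ (zeroFreeSequence L))) sum-L

  zero-free : ∀ {ys} → ys ⊆ ws → ZeroSum n ys → ys ≡ []
  zero-free = subst (λ n → ∀ {ys} → ys ⊆ ws → ZeroSum n ys → ys ≡ []) product-L (proj₂ (proj₂ (zeroFreeSequence L)))

  open Constants n′ D subsequence ws length-ws zero-free
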